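{- For all integers $a\geq 2$ and $n\geq 30$, \[\mathrm{ex}_{\Pi}\Bigl(n, 4, \tbinom{4}{2}a +3\Bigr) = \Pi_{2,1}(a,n).\]
   Context: A multigraph is a pair $G=(V,w)$ where $V$ is a finite set and $w:\binom{V}{2}\to\mathbb{Z}_{\geq 0}$ assigns a multiplicity to each pair. For $X\subseteq V$ write $e(G[X])=\sum_{xy\in\binom{X}{2}}w(xy)$ and $P(G)=\prod_{xy\in\binom{V}{2}}w(xy)$. Given integers $s\geq 2$, $q\geq 0$, $\mathcal{F}(n,s,q)$ denotes the set of multigraphs on vertex set $[n]=\{1,\dots,n\}$ in which every $s$-set $X$ of vertices satisfies $e(G[X])\leq q$, and $\mathrm{ex}_{\Pi}(n,s,q)=\max\{P(G): G\in\mathcal{F}(n,s,q)\}$. For positive integers $a,r$, $d\in\{0,1,\dots,a-1\}$ and $n$, $\mathcal{T}_{r,d}(a,n)$ is the set of multigraphs $G$ on $[n]$ whose vertex set can be partitioned into $r$ parts $V_0,\dots,V_{r-1}$ such that all pairs inside $V_0$ have multiplicity $a-d$, all pairs inside $V_i$ ($1\le i\le r-1$) have multiplicity $a$, and all other pairs have multiplicity $a+1$. $\Pi_{r,d}(a,n)=\max\{P(G):G\in\mathcal{T}_{r,d}(a,n)\}$. -}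

module Defs where

open import Data.Nat using (ℕ; zero; suc; _+_; _*_; _∸_; _<ᵇ_; _≤_)
open import Data.Bool using (Bool; true; false; if_then_else_; _∧_)
open import Data.Fin using (Fin; toℕ)
open import Data.Fin.Subset using (Subset; ∣_∣)
open import Data.Vec using (lookup)
open import Data.List using (List; []; _∷_; map; concatMap; allFin)
open import Data.Nat.ListAction using (sum; product)
open import Data.Product using (_×_; _,_; Σ; ∃)
open import Relation.Binary.PropositionalEquality using (_≡_)

-- A multigraph on [n] = Fin n: a multiplicity w i j for each i < j
-- (only entries with toℕ i < toℕ j are ever used, so each unordered
-- pair {i,j} is represented exactly once).
Multigraph : ℕ → Set
Multigraph n = Fin n → Fin n → ℕ

pairs : (n : ℕ) → List (Fin n × Fin n)
pairs n = concatMap (λ i → concatMap (λ j → if toℕ i <ᵇ toℕ j then (i , j) ∷ [] else [])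
                                      (allFin n))
                    (allFin n)

eIn : {n : ℕ} → Multigraph n → Subset n → ℕ
eIn {n} w X = sum (map (λ { (i , j) → if lookup X i ∧ lookup X j then w i j else 0 }) (pairs n))

P : {n : ℕ} → Multigraph n → ℕ
P {n} w = product (map (λ { (i , j) → w i j }) (pairs n))

InF : (n s q : ℕ) → Multigraph n → Set
InF n s q w = (X : Subset n) → ∣ X ∣ ≡ s → eIn w X ≤ q

-- G ∈ T_{r,d}(a,n): there is a partition of [n] into r (labelled) parts
-- V_0,...,V_{r-1}, given by f : Fin n → Fin r, with the prescribed multiplicities.
InT : (r d a n : ℕ) → Multigraph n → Set
InT r d a n w = Σ (Fin n → Fin r) λ f →
  (i j : Fin n) → toℕ i Data.Nat.< toℕ j →
    w i j ≡ (if toℕ (f i) Data.Nat.≡ᵇ toℕ (f j)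
             then (if toℕ (f i) Data.Nat.≡ᵇ 0 then a ∸ d else a)
             else suc a)

IsMaxP : (n : ℕ) → (Multigraph n → Set) → ℕ → Set
IsMaxP n S m = (∃ λ (w : Multigraph n) → S w × P w ≡ m)
             × ((w : Multigraph n) → S w → P w ≤ m)

{-# OPTIONS --safe #-}

-- Write b = a - 1, r = a + 1 and call pairs of multiplicity b, a, r blue, white, red; let T k l be
-- the product of the member of T_{2,1}(a, k + l) with |V_0| = k. A triple of weight ≥ 3a + 3, or
-- (failing that) a pair of weight ≥ a + 2, sends so little weight to the other vertices that deleting
-- it allows induction: adding as many vertices to V_1 costs more. Otherwise raising the lower
-- multiplicities to b preserves the hypothesis, so that all multiplicities are b, a or r, there is no
-- red triangle, and every red 4-cycle has a blue diagonal. Such graphs are closed under replacing a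
-- vertex by a blue clone of another one, so Zykov symmetrisation makes "equal or blue" an equivalence
-- relation whose classes consist of clones, and between classes red has girth at least 5. A red
-- 5-cycle, or else a red path on 4 vertices, again sends little weight to the rest and can be deleted.
-- Without either, the classes form a red star forest, and taking for V_0 the largest class and for
-- V_1 everything else shows that the product is at most T k l. The 5-cycle itself beats T k l by a
-- factor less than r / a; this defect disappears as soon as one more set is deleted.

module Submission where

open import Defs
open import Data.Bool as Bool using (Bool; true; false; if_then_else_; _∧_; T?)
open import Data.Empty using (⊥)
open import Data.Fin using (Fin; zero; suc; toℕ)
open import Data.Fin.Properties using (all?; toℕ-injective) renaming (_≟_ to _≟ᶠ_)
open import Data.Fin.Subset using (Subset; ∣_∣)
open import Data.List using (List; []; _∷_; _++_; map; concatMap; length; replicate; filter; filterᵇ; tabulate; allFin; upTo)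
open import Data.List.Extrema.Nat using (argmax; argmax-all; f[xs]≤f[argmax]; f[⊥]≤f[argmax])
open import Data.List.Membership.Propositional using (_∈_; _∉_; find; lose)
open import Data.List.Membership.Propositional.Properties using (∈-∃++; ∈-++⁻; ∈-++⁺ʳ; ∈-filter⁺; ∈-filter⁻; ∈-allFin; ∈-upTo⁺)
open import Data.List.Membership.Propositional.Properties.WithK using (unique∧set⇒bag)
open import Data.List.Properties using (map-++; map-∘; map-cong; map-tabulate; length-++; length-replicate; length-tabulate; filter-accept; filter-reject)
open import Data.List.Relation.Binary.BagAndSetEquality using (∼bag⇒↭)
open import Data.List.Relation.Binary.Permutation.Propositional as Perm using (_↭_; ↭-refl; ↭-sym; ↭-trans; prep; ↭⇒↭ₛ)
open import Data.List.Relation.Binary.Permutation.Propositional.Properties as Permₚ using (shift; shifts; ++-comm; ∈-resp-↭; ↭-length; filter-↭)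
import Data.List.Relation.Binary.Permutation.Setoid.Properties as PermSetoidₚ
open import Data.List.Relation.Unary.All as All using (All; []; _∷_)
open import Data.List.Relation.Unary.All.Properties using (all-upTo)
open import Data.List.Relation.Unary.AllPairs as AllPairs using (AllPairs; []; _∷_)
import Data.List.Relation.Unary.AllPairs.Properties as AllPairsₚ
open import Data.List.Relation.Unary.Any using (here; there; any?)
open import Data.List.Relation.Unary.Unique.Propositional using (Unique)
open import Data.List.Relation.Unary.Unique.Propositional.Properties using (allFin⁺; filter⁺)
open import Data.Nat using (ℕ; zero; suc; _+_; _*_; _^_; _∸_; _⊔_; _≤_; _<_; z≤n; s≤s; NonZero; _≟_; _≤?_; _<?_; _<ᵇ_; _≡ᵇ_)
open import Data.Nat.Induction using (<-wellFounded)
open import Data.Nat.ListAction using (sum; product)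
open import Data.Nat.ListAction.Properties using (sum-↭; sum-++; product-↭; product-++)
open import Data.Nat.Properties hiding (_≟_; _≤?_; _<?_)
open import Data.Nat.Tactic.RingSolver using (solve-∀)
open import Data.Product using (∃; _×_; _,_; proj₁; proj₂)
open import Data.Sum using (_⊎_; inj₁; inj₂; [_,_]′)
open import Data.Vec as Vec using ([]; _∷_; lookup)
open import Data.Vec.Properties using (lookup∘tabulate)
open import Function using (_∘_; mk⇔)
open import Induction.WellFounded using (Acc; acc)
open import Relation.Binary.Definitions using (DecidableEquality; tri<; tri≈; tri>)
open import Relation.Binary.PropositionalEquality
open import Relation.Nullary using (¬_; Dec; yes; no; does; contradiction; ¬?; _×-dec_)
open import Relation.Nullary.Decidable using (map′; dec-true; dec-false; from-yes; toWitness; fromWitness; ⌊_⌋)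

-- The optimal size of V_0 is never located: every bound is by some `T k l` whose sizes come out of
-- the induction. A deletion is compared with adding as many vertices to the two parts: a path goes
-- 1 to V_0 and 3 to V_1, a 5-cycle goes 1 and 4, a triple or a pair goes entirely to V_1. Apart
-- from b ≤ a ≤ r and AM-GM, two inequalities do the work: b r ≤ a a pays for clones of deleted
-- vertices, and a a a ≤ b r r pays for the vertices of V_0. It is repaid by the vertices of V_0,
-- each of which yields a spare factor r / a when a 5-cycle, a triple or a pair is deleted; so the
-- hypothesis must also guarantee enough of them. Powers of r / a are kept free of division by
-- pairing powers of a and r on opposite sides. Symmetrisation changes only the list of vertices and
-- never the weight function, so no property of the weights has to be proved again.

private variable
  V W : Set

-- Pair sums and pair products over lists of vertices.

weights : (V → V → ℕ) → List V → List ℕ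
weights w []       = []
weights w (x ∷ xs) = map (w x) xs ++ weights w xs

pairSum pairProduct : (V → V → ℕ) → List V → ℕ
pairSum     w xs = sum (weights w xs)
pairProduct w xs = product (weights w xs)

degree : (V → V → ℕ) → V → List V → ℕ
degree w x xs = product (map (w x) xs)

Symmetric : (V → V → ℕ) → Set
Symmetric w = ∀ x y → w x y ≡ w y x

weights-↭ : ∀ {w : V → V → ℕ} → Symmetric w → ∀ {xs ys} → xs ↭ ys → weights w xs ↭ weights w ys
weights-↭ sym-w Perm.refl = ↭-refl
weights-↭ {w = w} sym-w (Perm.prep x p) = Permₚ.++⁺ (Permₚ.map⁺ (w x) p) (weights-↭ sym-w p)
weights-↭ {w = w} sym-w (Perm.swap {xs} {ys} x y p) rewrite sym-w x y =
  prep (w y x) (↭-trans (shifts (map (w x) xs) (map (w y) xs))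
    (Permₚ.++⁺ (Permₚ.map⁺ (w y) p) (Permₚ.++⁺ (Permₚ.map⁺ (w x) p) (weights-↭ sym-w p))))
weights-↭ sym-w (Perm.trans p q) = ↭-trans (weights-↭ sym-w p) (weights-↭ sym-w q)

pairSum-↭ : ∀ {w : V → V → ℕ} → Symmetric w → ∀ {xs ys} → xs ↭ ys → pairSum w xs ≡ pairSum w ys
pairSum-↭ sym-w p = sum-↭ (weights-↭ sym-w p)

pairProduct-↭ : ∀ {w : V → V → ℕ} → Symmetric w → ∀ {xs ys} → xs ↭ ys → pairProduct w xs ≡ pairProduct w ys
pairProduct-↭ sym-w p = product-↭ (weights-↭ sym-w p)

pairProduct-∷ : ∀ (w : V → V → ℕ) x xs → pairProduct w (x ∷ xs) ≡ degree w x xs * pairProduct w xs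
pairProduct-∷ w x xs = product-++ (map (w x) xs) (weights w xs)

weights-cong : ∀ {w w′ : V → V → ℕ} {xs} → AllPairs (λ x y → w x y ≡ w′ x y) xs → weights w xs ≡ weights w′ xs
weights-cong []       = refl
weights-cong (p ∷ ps) = cong₂ _++_ (map-cong-All p) (weights-cong ps)
  where
  map-cong-All : ∀ {f g : V → ℕ} {xs} → All (λ x → f x ≡ g x) xs → map f xs ≡ map g xs
  map-cong-All []       = refl
  map-cong-All (q ∷ qs) = cong₂ _∷_ q (map-cong-All qs)

product-map-mono : ∀ {f g : V → ℕ} {xs} → All (λ x → f x ≤ g x) xs → product (map f xs) ≤ product (map g xs)
product-map-mono []       = ≤-refl
product-map-mono (p ∷ ps) = *-mono-≤ p (product-map-mono ps)

product-map-≤-^ : ∀ {f : V → ℕ} {K xs} → All (λ x → f x ≤ K) xs → product (map f xs) ≤ K ^ length xs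
product-map-≤-^ []       = ≤-refl
product-map-≤-^ (p ∷ ps) = *-mono-≤ p (product-map-≤-^ ps)

pairProduct-mono : ∀ {w w′ : V → V → ℕ} {xs} → AllPairs (λ x y → w x y ≤ w′ x y) xs → pairProduct w xs ≤ pairProduct w′ xs
pairProduct-mono [] = ≤-refl
pairProduct-mono {w = w} {w′} {x ∷ xs} (p ∷ ps) = begin
  pairProduct w (x ∷ xs)              ≡⟨ pairProduct-∷ w x xs ⟩
  degree w x xs * pairProduct w xs    ≤⟨ *-mono-≤ (product-map-mono p) (pairProduct-mono ps) ⟩
  degree w′ x xs * pairProduct w′ xs  ≡⟨ pairProduct-∷ w′ x xs ⟨
  pairProduct w′ (x ∷ xs)             ∎
  where open ≤-Reasoning

product-map-* : ∀ (f g : V → ℕ) xs → product (map (λ x → f x * g x) xs) ≡ product (map f xs) * product (map g xs)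
product-map-* f g []       = refl
product-map-* f g (x ∷ xs) = begin
  f x * g x * product (map (λ x → f x * g x) xs)                 ≡⟨ cong (f x * g x *_) (product-map-* f g xs) ⟩
  f x * g x * (product (map f xs) * product (map g xs))          ≡⟨ [m*n]*[o*p]≡[m*o]*[n*p] (f x) (g x) _ _ ⟩
  f x * product (map f xs) * (g x * product (map g xs))          ∎
  where open ≡-Reasoning

productTo : (V → V → ℕ) → List V → V → ℕ
productTo w S v = product (map (λ x → w x v) S)

pairProduct-++ : ∀ (w : V → V → ℕ) S xs →
  pairProduct w (S ++ xs) ≡ pairProduct w S * product (map (productTo w S) xs) * pairProduct w xs
pairProduct-++ w [] xs = trans (sym (*-identityˡ _)) (cong (_* pairProduct w xs) (sym (trans (*-identityˡ _) (product-map-1 xs))))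
  where
  product-map-1 : ∀ (xs : List V) → product (map (λ _ → 1) xs) ≡ 1
  product-map-1 []       = refl
  product-map-1 (_ ∷ xs) = trans (*-identityˡ _) (product-map-1 xs)
pairProduct-++ w (s ∷ S) xs = begin
  pairProduct w (s ∷ S ++ xs)
    ≡⟨ pairProduct-∷ w s (S ++ xs) ⟩
  degree w s (S ++ xs) * pairProduct w (S ++ xs)
    ≡⟨ cong₂ _*_ (trans (cong product (map-++ (w s) S xs)) (product-++ (map (w s) S) _)) (pairProduct-++ w S xs) ⟩
  degree w s S * degree w s xs * (pairProduct w S * product (map (productTo w S) xs) * pairProduct w xs)
    ≡⟨ rearrange (degree w s S) (degree w s xs) (pairProduct w S) _ _ ⟩
  degree w s S * pairProduct w S * (degree w s xs * product (map (productTo w S) xs)) * pairProduct w xs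
    ≡⟨ cong₂ (λ m n → m * n * pairProduct w xs) (pairProduct-∷ w s S) (product-map-* (w s) (productTo w S) xs) ⟨
  pairProduct w (s ∷ S) * product (map (productTo w (s ∷ S)) xs) * pairProduct w xs ∎
  where
  open ≡-Reasoning
  rearrange : ∀ a b c d e → a * b * (c * d * e) ≡ a * c * (b * d) * e
  rearrange = solve-∀

pairProduct-++-≤ : ∀ (w : V → V → ℕ) S {xs K} → All (λ v → productTo w S v ≤ K) xs →
  pairProduct w (S ++ xs) ≤ pairProduct w S * K ^ length xs * pairProduct w xs
pairProduct-++-≤ w S {xs} p = begin
  pairProduct w (S ++ xs)                                             ≡⟨ pairProduct-++ w S xs ⟩
  pairProduct w S * product (map (productTo w S) xs) * pairProduct w xs      ≤⟨ *-monoˡ-≤ (pairProduct w xs) (*-monoʳ-≤ (pairProduct w S) (product-map-≤-^ p)) ⟩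
  pairProduct w S * _ * pairProduct w xs                              ∎
  where open ≤-Reasoning

∃∈? : ∀ {P : V → Set} → (∀ x → Dec (P x)) → ∀ xs → Dec (∃ λ x → x ∈ xs × P x)
∃∈? P? xs = map′ find (λ { (_ , x∈xs , px) → lose x∈xs px }) (any? P? xs)

∈⇒↭∷ : ∀ {x : V} {xs} → x ∈ xs → ∃ λ ys → xs ↭ x ∷ ys
∈⇒↭∷ {x = x} x∈xs with ∈-∃++ x∈xs
... | ys , zs , refl = ys ++ zs , shift x ys zs

extract : ∀ {S xs : List V} → Unique S → All (_∈ xs) S → ∃ λ ys → xs ↭ S ++ ys
extract [] [] = _ , ↭-refl
extract {S = s ∷ S} (s∉S ∷ uniq) (s∈xs ∷ S⊆xs) with extract uniq S⊆xs
... | ys , p with ∈-++⁻ S (∈-resp-↭ p s∈xs)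
... | inj₁ s∈S  = contradiction refl (All.lookup s∉S s∈S)
... | inj₂ s∈ys with ∈⇒↭∷ s∈ys
... | zs , q = zs , ↭-trans p (↭-trans (Permₚ.++⁺ˡ S q) (shift s S zs))

∈-replicate⁻ : ∀ m {x y : V} → y ∈ replicate m x → y ≡ x
∈-replicate⁻ (suc m) (here y≡x) = y≡x
∈-replicate⁻ (suc m) (there p)  = ∈-replicate⁻ m p

AllPairs-lookup : ∀ {R : V → V → Set} {xs x y} → AllPairs R xs → x ∈ xs → y ∈ xs → x ≡ y ⊎ R x y ⊎ R y x
AllPairs-lookup (_ ∷ _)  (here refl) (here refl) = inj₁ refl
AllPairs-lookup (p ∷ _)  (here refl) (there y∈)  = inj₂ (inj₁ (All.lookup p y∈))
AllPairs-lookup (p ∷ _)  (there x∈)  (here refl) = inj₂ (inj₂ (All.lookup p x∈))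
AllPairs-lookup (_ ∷ ps) (there x∈)  (there y∈)  = AllPairs-lookup ps x∈ y∈

Unique-resp-↭ : ∀ {xs ys : List V} → xs ↭ ys → Unique xs → Unique ys
Unique-resp-↭ p = PermSetoidₚ.Unique-resp-↭ (setoid _) (↭⇒↭ₛ p)

AllPairs-∈ : ∀ {R S : V → V → Set} {xs} → (∀ {x y} → x ∈ xs → y ∈ xs → R x y → S x y) → AllPairs R xs → AllPairs S xs
AllPairs-∈ f []       = []
AllPairs-∈ f (p ∷ ps) = All.tabulate (λ y∈ → f (here refl) (there y∈) (All.lookup p y∈)) ∷ AllPairs-∈ (λ x∈ y∈ → f (there x∈) (there y∈)) ps

-- The pairs inside S may be arbitrarily heavy, so S is bounded only together with one vertex v of
-- the remainder; every other vertex then costs a factor K.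
pairProduct-++-∷-≤ : ∀ (w : V → V → ℕ) S {v vs C K} → pairProduct w (S ++ v ∷ []) ≤ C → All (λ u → productTo w S u ≤ K) vs →
  pairProduct w (S ++ v ∷ vs) ≤ C * K ^ length vs * pairProduct w (v ∷ vs)
pairProduct-++-∷-≤ w S {v} {vs} {C} {K} S+v≤C p = begin
  pairProduct w (S ++ v ∷ vs)
    ≡⟨ pairProduct-++ w S (v ∷ vs) ⟩
  pairProduct w S * (productTo w S v * product (map (productTo w S) vs)) * pairProduct w (v ∷ vs)
    ≡⟨ cong (_* pairProduct w (v ∷ vs)) (lemma (pairProduct w S) (productTo w S v) _) ⟩
  pairProduct w S * (productTo w S v * 1) * 1 * product (map (productTo w S) vs) * pairProduct w (v ∷ vs)
    ≡⟨ cong (λ z → z * product (map (productTo w S) vs) * pairProduct w (v ∷ vs)) (pairProduct-++ w S (v ∷ [])) ⟨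
  pairProduct w (S ++ v ∷ []) * product (map (productTo w S) vs) * pairProduct w (v ∷ vs)
    ≤⟨ *-monoˡ-≤ (pairProduct w (v ∷ vs)) (*-mono-≤ S+v≤C (product-map-≤-^ p)) ⟩
  C * K ^ length vs * pairProduct w (v ∷ vs) ∎
  where
  open ≤-Reasoning
  lemma : ∀ x y z → x * (y * z) ≡ x * (y * 1) * 1 * z
  lemma = solve-∀

^-distribʳ-* : ∀ n x y → (x * y) ^ n ≡ x ^ n * y ^ n
^-distribʳ-* zero    x y = refl
^-distribʳ-* (suc n) x y = trans (cong (x * y *_) (^-distribʳ-* n x y)) ([m*n]*[o*p]≡[m*o]*[n*p] x y (x ^ n) (y ^ n))

-- Arithmetic of the multiplicities b, a, r, and AM-GM without division.

tri : ℕ → ℕ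
tri zero    = 0
tri (suc n) = n + tri n

-- The 5-cycle exceeds T 2 3, but by a factor of at most r / a = (r / a) ^ δ 5.
δ : ℕ → ℕ
δ 5 = 1
δ _ = 0

δ-support : ∀ n → n ≡ 5 ⊎ δ n ≡ 0
δ-support 0 = inj₂ refl
δ-support 1 = inj₂ refl
δ-support 2 = inj₂ refl
δ-support 3 = inj₂ refl
δ-support 4 = inj₂ refl
δ-support 5 = inj₁ refl
δ-support (suc (suc (suc (suc (suc (suc _)))))) = inj₂ refl

module Multiplicities (b a r : ℕ) (1≤b : 1 ≤ b) (a≡1+b : a ≡ suc b) (r≡1+a : r ≡ suc a) where

  instance
    a≢0 : NonZero a
    a≢0 = subst NonZero (sym a≡1+b) _
    r≢0 : NonZero r
    r≢0 = subst NonZero (sym r≡1+a) _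

  b≤a : b ≤ a
  b≤a = ≤-trans (n≤1+n b) (≤-reflexive (sym a≡1+b))

  a≤r : a ≤ r
  a≤r = ≤-trans (n≤1+n a) (≤-reflexive (sym r≡1+a))

  br≤aa : b * r ≤ a * a
  br≤aa rewrite r≡1+a | a≡1+b = ≤-trans (m≤n+m _ 1) (≤-reflexive (lemma b))
    where
    lemma : ∀ b → 1 + b * (2 + b) ≡ (1 + b) * (1 + b)
    lemma = solve-∀

  -- With b = c + 1 the difference is c * c + 3 * c + 1. This is where a ≥ 2 enters: for b = 0 the
  -- right-hand side vanishes.
  aaa≤brr : a * (a * a) ≤ b * (r * r)
  aaa≤brr = bound b 1≤b a≡1+b r≡1+a
    where
    lemma : ∀ c → (2 + c) * ((2 + c) * (2 + c)) + (c * c + 3 * c + 1) ≡ (1 + c) * ((3 + c) * (3 + c))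
    lemma = solve-∀
    bound : ∀ b {a r} → 1 ≤ b → a ≡ suc b → r ≡ suc a → a * (a * a) ≤ b * (r * r)
    bound (suc c) _ refl refl = ≤-trans (m≤m+n _ (c * c + 3 * c + 1)) (≤-reflexive (lemma c))

  aaa≤brr-^ : ∀ k → a ^ k * (a ^ k * a ^ k) ≤ b ^ k * (r ^ k * r ^ k)
  aaa≤brr-^ k = subst₂ _≤_ (cube a a a) (cube b r r) (^-monoˡ-≤ k aaa≤brr)
    where
    cube : ∀ x y z → (x * (y * z)) ^ k ≡ x ^ k * (y ^ k * z ^ k)
    cube x y z = trans (^-distribʳ-* k x (y * z)) (cong (x ^ k *_) (^-distribʳ-* k y z))

  -- (r / a) ^ j ≤ (r / a) ^ k
  ratio-mono : ∀ {j k} → j ≤ k → r ^ j * a ^ k ≤ a ^ j * r ^ k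
  ratio-mono {k = k} z≤n = *-monoʳ-≤ 1 (^-monoˡ-≤ k a≤r)
  ratio-mono {suc j} {suc k} (s≤s j≤k) = subst₂ _≤_
    (lemma r a (r ^ j) (a ^ k)) (trans (cong (_* (a ^ j * r ^ k)) (*-comm r a)) (lemma a r (a ^ j) (r ^ k)))
    (*-monoʳ-≤ (r * a) (ratio-mono j≤k))
    where
    lemma : ∀ r a x y → r * a * (x * y) ≡ r * x * (a * y)
    lemma = solve-∀

  -- The tangent-line form of AM–GM: if w + d ≤ a + s then w ≤ a (r / a) ^ (s - d).
  tangent : ∀ w s d → w + d ≤ a + s → w * (a ^ s * r ^ d) ≤ a * (r ^ s * a ^ d)
  tangent w zero zero h = *-monoˡ-≤ 1 (subst₂ _≤_ (+-identityʳ w) (+-identityʳ a) h)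
  tangent w (suc s) (suc d) h = subst₂ _≤_
    (lemma w a r (a ^ s) (r ^ d)) (lemma′ a r (r ^ s) (a ^ d))
    (*-monoˡ-≤ (a * r) (tangent w s d (≤-pred (subst₂ _≤_ (+-suc w d) (+-suc a s) h))))
    where
    lemma : ∀ w a r x y → w * (x * y) * (a * r) ≡ w * (a * x * (r * y))
    lemma = solve-∀
    lemma′ : ∀ a r x y → a * (x * y) * (a * r) ≡ a * (r * x * (a * y))
    lemma′ = solve-∀
  tangent zero (suc s) zero h = z≤n
  tangent (suc w) (suc s) zero h = begin
    suc w * (a ^ suc s * 1)              ≡⟨ lemma w a (a ^ s) ⟩
    a * (w * (a ^ s * 1)) + a * a ^ s    ≤⟨ +-mono-≤ (*-monoʳ-≤ a (tangent w s zero (≤-pred (subst (suc w + 0 ≤_) (+-suc a s) h)))) (*-monoʳ-≤ a (^-monoˡ-≤ s a≤r)) ⟩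
    a * (a * (r ^ s * 1)) + a * r ^ s    ≡⟨ lemma′ a (r ^ s) ⟩
    a * (suc a * r ^ s * 1)              ≡⟨ cong (λ z → a * (z * r ^ s * 1)) r≡1+a ⟨
    a * (r ^ suc s * 1)                  ∎
    where
    open ≤-Reasoning
    lemma : ∀ w a x → suc w * (a * x * 1) ≡ a * (w * (x * 1)) + a * x
    lemma = solve-∀
    lemma′ : ∀ a x → a * (a * (x * 1)) + a * x ≡ a * (suc a * x * 1)
    lemma′ = solve-∀
  tangent w zero (suc d) h = begin
    w * (1 * r ^ suc d)          ≡⟨ lemma w r (r ^ d) ⟩
    w * r * r ^ d                ≤⟨ *-monoˡ-≤ (r ^ d) wr≤[1+w]a ⟩
    suc w * a * r ^ d            ≡⟨ lemma′ (suc w) a (r ^ d) ⟩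
    a * (suc w * (1 * r ^ d))    ≤⟨ *-monoʳ-≤ a (tangent (suc w) zero d (subst (_≤ a + 0) (+-suc w d) h)) ⟩
    a * (a * (1 * a ^ d))        ≡⟨ lemma″ a (a ^ d) ⟩
    a * (1 * a ^ suc d)          ∎
    where
    open ≤-Reasoning
    lemma : ∀ w r x → w * (1 * (r * x)) ≡ w * r * x
    lemma = solve-∀
    lemma′ : ∀ w a x → w * a * x ≡ a * (w * (1 * x))
    lemma′ = solve-∀
    lemma″ : ∀ a x → a * (a * (1 * x)) ≡ a * (1 * (a * x))
    lemma″ = solve-∀
    w≤a : w ≤ a
    w≤a = ≤-trans (m≤m+n w (suc d)) (subst (w + suc d ≤_) (+-identityʳ a) h)
    wr≤[1+w]a : w * r ≤ suc w * a
    wr≤[1+w]a = begin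
      w * r        ≡⟨ cong (w *_) r≡1+a ⟩
      w * suc a    ≡⟨ *-suc w a ⟩
      w + w * a    ≤⟨ +-monoˡ-≤ (w * a) w≤a ⟩
      suc w * a    ∎

  -- Multiplies the bounds w ≤ a (r / a) ^ (w - a) over the list. An exponent w - a may be negative,
  -- so it is kept as a surplus and a deficit: each entry adds a to `s` and w to `d` in the
  -- hypothesis for the tail, and the factor `K` cancels what this introduces.
  am-gm′ : ∀ ws s d → sum ws + d ≤ length ws * a + s →
           product ws * (a ^ s * r ^ d) ≤ a ^ length ws * (r ^ s * a ^ d)
  am-gm′ [] s d h = subst₂ _≤_
    (trans (*-comm (r ^ d) (a ^ s)) (sym (*-identityˡ _)))
    (trans (*-comm (a ^ d) (r ^ s)) (sym (*-identityˡ _)))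
    (ratio-mono h)
  am-gm′ (w ∷ ws) s d h = *-cancelʳ-≤ _ _ K {{K≢0}} (begin
    w * product ws * (a ^ s * r ^ d) * K
      ≡⟨ lemma w (product ws) (a ^ s) (r ^ d) (a ^ a) (a ^ w) (r ^ a) (r ^ w) ⟩
    w * (a ^ w * r ^ a) * (product ws * ((a ^ a * a ^ s) * (r ^ w * r ^ d)))
      ≡⟨ cong₂ (λ x y → w * (a ^ w * r ^ a) * (product ws * (x * y))) (^-distribˡ-+-* a a s) (^-distribˡ-+-* r w d) ⟨
    w * (a ^ w * r ^ a) * (product ws * (a ^ (a + s) * r ^ (w + d)))
      ≤⟨ *-mono-≤ (tangent w w a (≤-reflexive (+-comm w a))) (am-gm′ ws (a + s) (w + d) h′) ⟩
    a * (r ^ w * a ^ a) * (a ^ length ws * (r ^ (a + s) * a ^ (w + d)))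
      ≡⟨ cong₂ (λ x y → a * (r ^ w * a ^ a) * (a ^ length ws * (x * y))) (^-distribˡ-+-* r a s) (^-distribˡ-+-* a w d) ⟩
    a * (r ^ w * a ^ a) * (a ^ length ws * (r ^ a * r ^ s * (a ^ w * a ^ d)))
      ≡⟨ lemma′ a (a ^ length ws) (r ^ s) (a ^ d) (a ^ a) (a ^ w) (r ^ a) (r ^ w) ⟩
    a ^ suc (length ws) * (r ^ s * a ^ d) * K ∎)
    where
    open ≤-Reasoning
    K = (a ^ a * a ^ w) * (r ^ a * r ^ w)
    K≢0 : NonZero K
    K≢0 = m*n≢0 _ _ {{m*n≢0 _ _ {{m^n≢0 a a}} {{m^n≢0 a w}}}} {{m*n≢0 _ _ {{m^n≢0 r a}} {{m^n≢0 r w}}}}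
    lemma : ∀ w p x y A B C D → w * p * (x * y) * ((A * B) * (C * D)) ≡ w * (B * C) * (p * ((A * x) * (D * y)))
    lemma = solve-∀
    lemma′ : ∀ a L x y A B C D → a * (D * A) * (L * (C * x * (B * y))) ≡ a * L * (x * y) * ((A * B) * (C * D))
    lemma′ = solve-∀
    lemma₁ : ∀ w S d → S + (w + d) ≡ w + S + d
    lemma₁ = solve-∀
    lemma₂ : ∀ a L s → a + L + s ≡ L + (a + s)
    lemma₂ = solve-∀
    h′ : sum ws + (w + d) ≤ length ws * a + (a + s)
    h′ = subst₂ _≤_ (sym (lemma₁ w (sum ws) d)) (lemma₂ a (length ws * a) s) h

  am-gm : ∀ ws s → sum ws ≤ length ws * a + s → product ws * a ^ s ≤ a ^ length ws * r ^ s
  am-gm ws s h = subst₂ _≤_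
    (cong (product ws *_) (*-identityʳ _)) (cong (a ^ length ws *_) (*-identityʳ _))
    (am-gm′ ws s 0 (≤-trans (≤-reflexive (+-identityʳ _)) h))

  -- The extremal products `T k l` and the cost of deletions.

  T : ℕ → ℕ → ℕ
  T k l = b ^ tri k * a ^ tri l * r ^ (k * l)

  T-sucʳ : ∀ k l → T k (suc l) ≡ T k l * (a ^ l * r ^ k)
  T-sucʳ k l = begin
    b ^ tri k * a ^ (l + tri l) * r ^ (k * suc l)
      ≡⟨ cong₂ (λ x y → b ^ tri k * x * y) (^-distribˡ-+-* a l (tri l)) (trans (cong (r ^_) (*-suc k l)) (^-distribˡ-+-* r k (k * l))) ⟩
    b ^ tri k * (a ^ l * a ^ tri l) * (r ^ k * r ^ (k * l))
      ≡⟨ lemma (b ^ tri k) (a ^ l) (a ^ tri l) (r ^ k) (r ^ (k * l)) ⟩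
    T k l * (a ^ l * r ^ k) ∎
    where
    open ≡-Reasoning
    lemma : ∀ x y z u v → x * (y * z) * (u * v) ≡ x * z * v * (y * u)
    lemma = solve-∀

  T-sucˡ : ∀ k l → T (suc k) l ≡ T k l * (b ^ k * r ^ l)
  T-sucˡ k l = begin
    b ^ (k + tri k) * a ^ tri l * r ^ (l + k * l)
      ≡⟨ cong₂ (λ x y → x * a ^ tri l * y) (^-distribˡ-+-* b k (tri k)) (^-distribˡ-+-* r l (k * l)) ⟩
    b ^ k * b ^ tri k * a ^ tri l * (r ^ l * r ^ (k * l))
      ≡⟨ lemma (b ^ k) (b ^ tri k) (a ^ tri l) (r ^ l) (r ^ (k * l)) ⟩
    T k l * (b ^ k * r ^ l) ∎
    where
    open ≡-Reasoning
    lemma : ∀ x y z u v → x * y * z * (u * v) ≡ y * z * v * (x * u)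
    lemma = solve-∀

  -- A vertex moved from V_1 to V_0 trades a ^ l * r ^ k for b ^ k * r ^ l. Once l ≥ 3 k this is a
  -- gain: each of the k old vertices of V_0 is charged a a a r against b r r r, and the j further
  -- ones a against r. Needed only to make k large enough for `Bounded`.
  T-shift : ∀ k j → T k (suc (k + k + k + j)) ≤ T (suc k) (k + k + k + j)
  T-shift k j = begin
    T k (suc l)                                     ≡⟨ T-sucʳ k l ⟩
    T k l * (a ^ l * r ^ k)                         ≡⟨ cong (λ z → T k l * (z * r ^ k)) (split a) ⟩
    T k l * (A * A * A * a ^ j * r ^ k)             ≡⟨ lemma (T k l) A (a ^ j) R ⟩
    T k l * (A * (A * A)) * (R * a ^ j)             ≤⟨ *-mono-≤ (*-monoʳ-≤ (T k l) (aaa≤brr-^ k)) (*-monoʳ-≤ R (^-monoˡ-≤ j a≤r)) ⟩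
    T k l * (b ^ k * (R * R)) * (R * r ^ j)         ≡⟨ lemma′ (T k l) (b ^ k) R (r ^ j) ⟩
    T k l * (b ^ k * (R * R * R * r ^ j))           ≡⟨ cong (λ z → T k l * (b ^ k * z)) (split r) ⟨
    T k l * (b ^ k * r ^ l)                         ≡⟨ T-sucˡ k l ⟨
    T (suc k) l                                     ∎
    where
    open ≤-Reasoning
    l = k + k + k + j
    A = a ^ k
    R = r ^ k
    split : ∀ x → x ^ l ≡ x ^ k * x ^ k * x ^ k * x ^ j
    split x = trans (^-distribˡ-+-* x (k + k + k) j) (cong (_* x ^ j)
      (trans (^-distribˡ-+-* x (k + k) k) (cong (_* x ^ k) (^-distribˡ-+-* x k k))))
    lemma : ∀ t A x R → t * (A * A * A * x * R) ≡ t * (A * (A * A)) * (R * x)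
    lemma = solve-∀
    lemma′ : ∀ t B R x → t * (B * (R * R)) * (R * x) ≡ t * (B * (R * R * R * x))
    lemma′ = solve-∀

  -- Allows the defect (r / a) ^ δ n. The condition δ n < k lets the next deletion cancel it: each
  -- vertex of V_0 yields a spare factor r / a, one of these factors covers a loss of the deletion
  -- itself, and δ n more cover the defect.
  Bounded : ℕ → ℕ → Set
  Bounded n X = ∃ λ k → ∃ λ l → k + l ≡ n × δ n < k × X * a ^ δ n ≤ T k l * r ^ δ n

  T-bounded : ℕ → ℕ → Set
  T-bounded n X = ∃ λ k → ∃ λ l → k + l ≡ n × X ≤ T k l

  T-bounded⇒0<k : ∀ {n X} → 0 < n → T-bounded n X → ∃ λ k → ∃ λ l → suc k + l ≡ n × X ≤ T (suc k) l
  T-bounded⇒0<k 0<n (suc k , l , eq , h) = k , l , eq , h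
  T-bounded⇒0<k 0<n (zero , suc l , eq , h) = 0 , l , eq , ≤-trans h (T-shift 0 l)
  T-bounded⇒0<k () (zero , zero , refl , h)

  T-bounded⇒Bounded : ∀ {n X} → 0 < n → T-bounded n X → Bounded n X
  T-bounded⇒Bounded {n} 0<n t with T-bounded⇒0<k 0<n t
  ... | k , l , eq , h with δ-support n
  ... | inj₂ δ≡0 rewrite δ≡0 = suc k , l , eq , s≤s z≤n , *-monoˡ-≤ 1 h
  T-bounded⇒Bounded 0<n t | suc k , l , eq , h | inj₁ refl =
    2 + k , l , eq , s≤s (s≤s z≤n) , *-mono-≤ h (*-monoˡ-≤ 1 a≤r)
  -- Five vertices require k ≥ 2, so 1 + 4 is traded for 2 + 3.
  T-bounded⇒Bounded 0<n t | zero , .4 , refl , h | inj₁ refl =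
    2 , 3 , refl , s≤s (s≤s z≤n) , *-mono-≤ (≤-trans h (T-shift 1 0)) (*-monoˡ-≤ 1 a≤r)

  Bounded⇒T-bounded : ∀ {n X} → n ≢ 5 → Bounded n X → T-bounded n X
  Bounded⇒T-bounded {n} n≢5 (k , l , eq , _ , h) with δ-support n
  ... | inj₁ n≡5 = contradiction n≡5 n≢5
  ... | inj₂ δ≡0 rewrite δ≡0 = k , l , eq , subst₂ _≤_ (*-identityʳ _) (*-identityʳ _) h

  -- The four vertices are replaced by 1 + 3. Either way there is a ^ 3 r ^ 3 inside, and a vertex
  -- of V_1 sees a ^ 3 r; a vertex of V_0 sees b r ^ 3, which is at least a ^ 3 r by `aaa≤brr`.
  remove₄ : ∀ {n X Y} → T-bounded n X → Y ≤ a * a * a * (r * r * r) * (a * (a * (a * r))) ^ n * X → T-bounded (4 + n) Y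
  remove₄ {X = X} {Y = Y} (k , l , refl , X≤T) h = suc k , 3 + l , eq k l , (begin
    Y
      ≤⟨ h ⟩
    a * a * a * (r * r * r) * (a * (a * (a * r))) ^ (k + l) * X
      ≤⟨ *-mono-≤ (≤-reflexive (cong (a * a * a * (r * r * r) *_) (trans (^-distribˡ-+-* _ k l) (cong₂ _*_ (split k) (split l))))) X≤T ⟩
    a * a * a * (r * r * r) * (A * (A * (A * R)) * (B * (B * (B * S)))) * T k l
      ≡⟨ lemma (T k l) a r A B R S ⟩
    T k l * (a * a * a * (r * r * r) * (B * B * B) * R * S) * (A * (A * A))
      ≤⟨ *-monoʳ-≤ (T k l * (a * a * a * (r * r * r) * (B * B * B) * R * S)) (aaa≤brr-^ k) ⟩
    T k l * (a * a * a * (r * r * r) * (B * B * B) * R * S) * (b ^ k * (R * R))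
      ≡⟨ lemma′ (T k l) (b ^ k) a r B R S ⟩
    T k l * (b ^ k * S) * (B * (r * R)) * (a * B * (r * R)) * (a * (a * B) * (r * R))
      ≡⟨ cong (λ z → z * (B * (r * R)) * (a * B * (r * R)) * (a * (a * B) * (r * R))) (T-sucˡ k l) ⟨
    T (suc k) l * (B * (r * R)) * (a * B * (r * R)) * (a * (a * B) * (r * R))
      ≡⟨ cong (λ z → z * (a * B * (r * R)) * (a * (a * B) * (r * R))) (T-sucʳ (suc k) l) ⟨
    T (suc k) (1 + l) * (a * B * (r * R)) * (a * (a * B) * (r * R))
      ≡⟨ cong (λ z → z * (a * (a * B) * (r * R))) (T-sucʳ (suc k) (1 + l)) ⟨
    T (suc k) (2 + l) * (a * (a * B) * (r * R))
      ≡⟨ T-sucʳ (suc k) (2 + l) ⟨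
    T (suc k) (3 + l) ∎)
    where
    open ≤-Reasoning
    A = a ^ k
    B = a ^ l
    R = r ^ k
    S = r ^ l
    eq : ∀ k l → suc k + (3 + l) ≡ 4 + (k + l)
    eq = solve-∀
    split : ∀ n → (a * (a * (a * r))) ^ n ≡ a ^ n * (a ^ n * (a ^ n * r ^ n))
    split n = trans (^-distribʳ-* n a _) (cong (a ^ n *_) (trans (^-distribʳ-* n a _) (cong (a ^ n *_) (^-distribʳ-* n a r))))
    lemma : ∀ t a r A B R S → a * a * a * (r * r * r) * (A * (A * (A * R)) * (B * (B * (B * S)))) * t
          ≡ t * (a * a * a * (r * r * r) * (B * B * B) * R * S) * (A * (A * A))
    lemma = solve-∀
    lemma′ : ∀ t β a r B R S → t * (a * a * a * (r * r * r) * (B * B * B) * R * S) * (β * (R * R))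
           ≡ t * (β * S) * (B * (r * R)) * (a * B * (r * R)) * (a * (a * B) * (r * R))
    lemma′ = solve-∀

  -- The five vertices are replaced by 1 + 4, with only a ^ 6 r ^ 4 inside, a factor r / a short.
  -- But a vertex of V_0 sees b r ^ 4, which exceeds a ^ 4 r by at least the factor r / a, and there
  -- are more than δ n such vertices: enough for this loss and for the defect.
  remove₅ : ∀ {n X Y} → Bounded n X →
    Y ≤ a * a * a * a * a * (r * r * r * r * r) * (a * (a * (a * (a * r)))) ^ n * X → T-bounded (5 + n) Y
  remove₅ {n} {X} {Y} (k , l , refl , δ<k , X≤T) h = suc k , 4 + l , eq k l , *-cancelʳ-≤ _ _ D {{m^n≢0 a (δ n)}} (begin
    Y * D
      ≤⟨ *-monoˡ-≤ D h ⟩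
    a * a * a * a * a * (r * r * r * r * r) * (a * (a * (a * (a * r)))) ^ (k + l) * X * D
      ≡⟨ cong (λ z → a * a * a * a * a * (r * r * r * r * r) * z * X * D) (trans (^-distribˡ-+-* _ k l) (cong₂ _*_ (split k) (split l))) ⟩
    a * a * a * a * a * (r * r * r * r * r) * (A * (A * (A * (A * R))) * (B * (B * (B * (B * S))))) * X * D
      ≡⟨ *-assoc (a * a * a * a * a * (r * r * r * r * r) * (A * (A * (A * (A * R))) * (B * (B * (B * (B * S)))))) X D ⟩
    a * a * a * a * a * (r * r * r * r * r) * (A * (A * (A * (A * R))) * (B * (B * (B * (B * S))))) * (X * D)
      ≤⟨ *-monoʳ-≤ (a * a * a * a * a * (r * r * r * r * r) * (A * (A * (A * (A * R))) * (B * (B * (B * (B * S)))))) X≤T ⟩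
    a * a * a * a * a * (r * r * r * r * r) * (A * (A * (A * (A * R))) * (B * (B * (B * (B * S))))) * (T k l * E)
      ≡⟨ lemma (T k l) E a r A B R S ⟩
    T k l * (a * a * a * a * a * (r * r * r * r) * (B * B * B * B) * R * S) * ((A * (A * A)) * (r * E * A))
      ≤⟨ *-monoʳ-≤ (T k l * (a * a * a * a * a * (r * r * r * r) * (B * B * B * B) * R * S)) (*-mono-≤ (aaa≤brr-^ k) (ratio-mono δ<k)) ⟩
    T k l * (a * a * a * a * a * (r * r * r * r) * (B * B * B * B) * R * S) * ((b ^ k * (R * R)) * (a * D * R))
      ≡⟨ lemma′ (T k l) (b ^ k) D a r B R S ⟩
    T k l * (b ^ k * S) * (B * (r * R)) * (a * B * (r * R)) * (a * (a * B) * (r * R)) * (a * (a * (a * B)) * (r * R)) * D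
      ≡⟨ cong (λ z → z * (B * (r * R)) * (a * B * (r * R)) * (a * (a * B) * (r * R)) * (a * (a * (a * B)) * (r * R)) * D) (T-sucˡ k l) ⟨
    T (suc k) l * (B * (r * R)) * (a * B * (r * R)) * (a * (a * B) * (r * R)) * (a * (a * (a * B)) * (r * R)) * D
      ≡⟨ cong (λ z → z * (a * B * (r * R)) * (a * (a * B) * (r * R)) * (a * (a * (a * B)) * (r * R)) * D) (T-sucʳ (suc k) l) ⟨
    T (suc k) (1 + l) * (a * B * (r * R)) * (a * (a * B) * (r * R)) * (a * (a * (a * B)) * (r * R)) * D
      ≡⟨ cong (λ z → z * (a * (a * B) * (r * R)) * (a * (a * (a * B)) * (r * R)) * D) (T-sucʳ (suc k) (1 + l)) ⟨
    T (suc k) (2 + l) * (a * (a * B) * (r * R)) * (a * (a * (a * B)) * (r * R)) * D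
      ≡⟨ cong (λ z → z * (a * (a * (a * B)) * (r * R)) * D) (T-sucʳ (suc k) (2 + l)) ⟨
    T (suc k) (3 + l) * (a * (a * (a * B)) * (r * R)) * D
      ≡⟨ cong (_* D) (T-sucʳ (suc k) (3 + l)) ⟨
    T (suc k) (4 + l) * D ∎)
    where
    open ≤-Reasoning
    A = a ^ k
    B = a ^ l
    R = r ^ k
    S = r ^ l
    D = a ^ δ n
    E = r ^ δ n
    eq : ∀ k l → suc k + (4 + l) ≡ 5 + (k + l)
    eq = solve-∀
    split : ∀ n → (a * (a * (a * (a * r)))) ^ n ≡ a ^ n * (a ^ n * (a ^ n * (a ^ n * r ^ n)))
    split n = trans (^-distribʳ-* n a _) (cong (a ^ n *_) (trans (^-distribʳ-* n a _) (cong (a ^ n *_)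
      (trans (^-distribʳ-* n a _) (cong (a ^ n *_) (^-distribʳ-* n a r))))))
    lemma : ∀ t e a r A B R S → a * a * a * a * a * (r * r * r * r * r) * (A * (A * (A * (A * R))) * (B * (B * (B * (B * S))))) * (t * e)
          ≡ t * (a * a * a * a * a * (r * r * r * r) * (B * B * B * B) * R * S) * ((A * (A * A)) * (r * e * A))
    lemma = solve-∀
    lemma′ : ∀ t β d a r B R S → t * (a * a * a * a * a * (r * r * r * r) * (B * B * B * B) * R * S) * ((β * (R * R)) * (a * d * R))
           ≡ t * (β * S) * (B * (r * R)) * (a * B * (r * R)) * (a * (a * B) * (r * R)) * (a * (a * (a * B)) * (r * R)) * d
    lemma′ = solve-∀

  -- The three vertices are replaced by vertices of V_1. Each vertex of V_0 then sees r ^ 3 instead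
  -- of a ^ 3; these surplus factors pay for having a ^ 3 instead of r ^ 3 inside, and for the
  -- defect.
  remove₃ : ∀ {n X Y} → Bounded n X → Y ≤ r * r * r * (a * (a * a)) ^ n * X → T-bounded (3 + n) Y
  remove₃ {n} {X} {Y} (k , l , refl , δ<k , X≤T) h = k , 3 + l , eq k l , *-cancelʳ-≤ _ _ D {{m^n≢0 a (δ n)}} (begin
    Y * D
      ≤⟨ *-monoˡ-≤ D h ⟩
    r * r * r * (a * (a * a)) ^ (k + l) * X * D
      ≡⟨ trans (cong (λ z → r * r * r * z * X * D) (trans (^-distribˡ-+-* _ k l) (cong₂ _*_ (split k) (split l)))) (*-assoc (r * r * r * (A * (A * A) * (B * (B * B)))) X D) ⟩
    r * r * r * (A * (A * A) * (B * (B * B))) * (X * D)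
      ≤⟨ *-monoʳ-≤ (r * r * r * (A * (A * A) * (B * (B * B)))) X≤T ⟩
    r * r * r * (A * (A * A) * (B * (B * B))) * (T k l * E)
      ≡⟨ lemma (T k l) E r A B ⟩
    T k l * (B * B * B) * ((r * 1 * A) * (r * 1 * A) * (r * E * A))
      ≤⟨ *-monoʳ-≤ (T k l * (B * B * B)) (*-mono-≤ (*-mono-≤ (ratio-mono 0<k) (ratio-mono 0<k)) (ratio-mono δ<k)) ⟩
    T k l * (B * B * B) * ((a * 1 * R) * (a * 1 * R) * (a * D * R))
      ≡⟨ lemma′ (T k l) D a B R ⟩
    T k l * (B * R) * (a * B * R) * (a * (a * B) * R) * D
      ≡⟨ cong (λ z → z * (a * B * R) * (a * (a * B) * R) * D) (T-sucʳ k l) ⟨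
    T k (1 + l) * (a * B * R) * (a * (a * B) * R) * D
      ≡⟨ cong (λ z → z * (a * (a * B) * R) * D) (T-sucʳ k (1 + l)) ⟨
    T k (2 + l) * (a * (a * B) * R) * D
      ≡⟨ cong (_* D) (T-sucʳ k (2 + l)) ⟨
    T k (3 + l) * D ∎)
    where
    open ≤-Reasoning
    A = a ^ k
    B = a ^ l
    R = r ^ k
    D = a ^ δ n
    E = r ^ δ n
    0<k : 0 < k
    0<k = ≤-trans (s≤s z≤n) δ<k
    eq : ∀ k l → k + (3 + l) ≡ 3 + (k + l)
    eq = solve-∀
    split : ∀ n → (a * (a * a)) ^ n ≡ a ^ n * (a ^ n * a ^ n)
    split n = trans (^-distribʳ-* n a _) (cong (a ^ n *_) (^-distribʳ-* n a a))
    lemma : ∀ t e r A B → r * r * r * (A * (A * A) * (B * (B * B))) * (t * e) ≡ t * (B * B * B) * ((r * 1 * A) * (r * 1 * A) * (r * e * A))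
    lemma = solve-∀
    lemma′ : ∀ t d a B R → t * (B * B * B) * ((a * 1 * R) * (a * 1 * R) * (a * d * R)) ≡ t * (B * R) * (a * B * R) * (a * (a * B) * R) * d
    lemma′ = solve-∀

  -- Both vertices are replaced by vertices of V_1, as for triples. The factor a on the left clears
  -- a denominator: the pair and one further vertex together cost a r r, while (a * a) ^ n also
  -- charges a a for that vertex.
  remove₂ : ∀ {n X Y} → Bounded n X → Y * a ≤ r * r * (a * a) ^ n * X → T-bounded (2 + n) Y
  remove₂ {n} {X} {Y} (k , l , refl , δ<k , X≤T) h = k , 2 + l , eq k l , *-cancelʳ-≤ _ _ (a * D) {{m*n≢0 a D {{a≢0}} {{m^n≢0 a (δ n)}}}} (begin
    Y * (a * D)
      ≡⟨ *-assoc Y a D ⟨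
    Y * a * D
      ≤⟨ *-monoˡ-≤ D h ⟩
    r * r * (a * a) ^ (k + l) * X * D
      ≡⟨ trans (cong (λ z → r * r * z * X * D) (trans (^-distribˡ-+-* _ k l) (cong₂ _*_ (^-distribʳ-* k a a) (^-distribʳ-* l a a)))) (*-assoc (r * r * (A * A * (B * B))) X D) ⟩
    r * r * (A * A * (B * B)) * (X * D)
      ≤⟨ *-monoʳ-≤ (r * r * (A * A * (B * B))) X≤T ⟩
    r * r * (A * A * (B * B)) * (T k l * E)
      ≡⟨ lemma (T k l) E r A B ⟩
    T k l * (B * B) * ((r * 1 * A) * (r * E * A))
      ≤⟨ *-monoʳ-≤ (T k l * (B * B)) (*-mono-≤ (ratio-mono 0<k) (ratio-mono δ<k)) ⟩
    T k l * (B * B) * ((a * 1 * R) * (a * D * R))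
      ≡⟨ lemma′ (T k l) D a B R ⟩
    T k l * (B * R) * (a * B * R) * (a * D)
      ≡⟨ cong (λ z → z * (a * B * R) * (a * D)) (T-sucʳ k l) ⟨
    T k (1 + l) * (a * B * R) * (a * D)
      ≡⟨ cong (_* (a * D)) (T-sucʳ k (1 + l)) ⟨
    T k (2 + l) * (a * D) ∎)
    where
    open ≤-Reasoning
    A = a ^ k
    B = a ^ l
    R = r ^ k
    D = a ^ δ n
    E = r ^ δ n
    0<k : 0 < k
    0<k = ≤-trans (s≤s z≤n) δ<k
    eq : ∀ k l → k + (2 + l) ≡ 2 + (k + l)
    eq = solve-∀
    lemma : ∀ t e r A B → r * r * (A * A * (B * B)) * (t * e) ≡ t * (B * B) * ((r * 1 * A) * (r * e * A))
    lemma = solve-∀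
    lemma′ : ∀ t d a B R → t * (B * B) * ((a * 1 * R) * (a * d * R)) ≡ t * (B * R) * (a * B * R) * (a * d)
    lemma′ = solve-∀

  -- Graphs with multiplicities b, a, r and restricted red cycles.

  -- With a blue diagonal, a list with repetitions describes a graph with blue clones.
  record Nice (w : V → V → ℕ) : Set where
    field
      symmetric  : Symmetric w
      diagonal   : ∀ x → w x x ≡ b
      range      : ∀ x y → w x y ≡ b ⊎ w x y ≡ a ⊎ w x y ≡ r
      triangle   : ∀ {x y z} → w x y ≡ r → w y z ≡ r → w z x ≡ r → ⊥
      four-cycle : ∀ {x y z t} → w x y ≡ r → w y z ≡ r → w z t ≡ r → w t x ≡ r → w x z ≡ b ⊎ w y t ≡ b

  b≢r : b ≢ r
  b≢r b≡r = <-irrefl b≡r (≤-trans (≤-reflexive (sym a≡1+b)) a≤r)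

  -- This is r * a ^ n, nested so that it unfolds to the literal bounds `a * (a * (a * r))` of the
  -- deletions.
  almost : ℕ → ℕ
  almost zero    = r
  almost (suc n) = a * almost n

  almost≡ : ∀ n → r * a ^ n ≡ almost n
  almost≡ zero    = *-identityʳ r
  almost≡ (suc n) = trans (lemma r a (a ^ n)) (cong (a *_) (almost≡ n))
    where
    lemma : ∀ r a x → r * (a * x) ≡ a * (r * x)
    lemma = solve-∀

  -- The hypothesis is the product of a red 5-cycle with white diagonals. Against T 2 3 with one
  -- extra factor r / a, `aaa≤brr` is all that is missing.
  cycle-bounded : ∀ {X} → X ≤ a * a * a * a * a * (r * r * r * r * r) → Bounded 5 X
  cycle-bounded {X} h = 2 , 3 , refl , s≤s (s≤s z≤n) , (begin
    X * (a * 1)                                                              ≤⟨ *-monoˡ-≤ (a * 1) h ⟩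
    a * a * a * a * a * (r * r * r * r * r) * (a * 1)                        ≡⟨ lemma a r ⟩
    a * (a * a) * (a * a * a * r * r * r * r * r)                            ≤⟨ *-monoˡ-≤ (a * a * a * r * r * r * r * r) aaa≤brr ⟩
    b * (r * r) * (a * a * a * r * r * r * r * r)                            ≡⟨ lemma′ b a r ⟩
    T 2 3 * (r * 1)                                                          ∎)
    where
    open ≤-Reasoning
    lemma : ∀ a r → a * a * a * a * a * (r * r * r * r * r) * (a * 1) ≡ a * (a * a) * (a * a * a * r * r * r * r * r)
    lemma = solve-∀
    lemma′ : ∀ b a r → b * (r * r) * (a * a * a * r * r * r * r * r)
           ≡ b * 1 * (a * (a * (a * 1))) * (r * (r * (r * (r * (r * (r * 1)))))) * (r * 1)
    lemma′ = solve-∀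

  module _ {V : Set} (_≟ⱽ_ : DecidableEquality V) {w : V → V → ℕ} (nice : Nice w) where
    open Nice nice

    Red : V → V → Set
    Red x y = w x y ≡ r

    red? : ∀ x y → Dec (Red x y)
    red? x y = w x y ≟ r

    red-sym : ∀ {x y} → Red x y → Red y x
    red-sym {x} {y} = trans (symmetric y x)

    red⇒≢ : ∀ {x y} → Red x y → x ≢ y
    red⇒≢ {x} xx refl = b≢r (trans (sym (diagonal x)) xx)

    ≤r : ∀ x y → w x y ≤ r
    ≤r x y with range x y
    ... | inj₁ p        = ≤-trans (≤-reflexive p) (≤-trans b≤a a≤r)
    ... | inj₂ (inj₁ p) = ≤-trans (≤-reflexive p) a≤r
    ... | inj₂ (inj₂ p) = ≤-reflexive p

    ¬red⇒≤a : ∀ {x y} → ¬ Red x y → w x y ≤ a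
    ¬red⇒≤a {x} {y} ¬red with range x y
    ... | inj₁ p        = ≤-trans (≤-reflexive p) b≤a
    ... | inj₂ (inj₁ p) = ≤-reflexive p
    ... | inj₂ (inj₂ p) = contradiction p ¬red

    -- Symmetrisation: blue classes are merged until distinct vertices are never blue.

    Pure : List V → Set
    Pure L = ∀ {x y} → x ∈ L → y ∈ L → w x y ≡ b → x ≡ y

    degree-replicate-++ : ∀ {x y} → w x y ≡ b → ∀ m L → degree w x (replicate m y ++ L) ≡ b ^ m * degree w x L
    degree-replicate-++ xy zero    L = sym (*-identityˡ _)
    degree-replicate-++ xy (suc m) L = trans (cong₂ _*_ xy (degree-replicate-++ xy m L)) (sym (*-assoc b (b ^ m) _))

    pairProduct-replicate-++ : ∀ m x L →
      pairProduct w (replicate m x ++ L) ≡ b ^ tri m * degree w x L ^ m * pairProduct w L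
    pairProduct-replicate-++ zero    x L = sym (*-identityˡ _)
    pairProduct-replicate-++ (suc m) x L = begin
      pairProduct w (x ∷ replicate m x ++ L)
        ≡⟨ pairProduct-∷ w x (replicate m x ++ L) ⟩
      degree w x (replicate m x ++ L) * pairProduct w (replicate m x ++ L)
        ≡⟨ cong₂ _*_ (degree-replicate-++ (diagonal x) m L) (pairProduct-replicate-++ m x L) ⟩
      b ^ m * d * (b ^ tri m * d ^ m * pairProduct w L)
        ≡⟨ lemma (b ^ m) d (b ^ tri m) (d ^ m) (pairProduct w L) ⟩
      b ^ m * b ^ tri m * (d * d ^ m) * pairProduct w L
        ≡⟨ cong (λ z → z * (d * d ^ m) * pairProduct w L) (^-distribˡ-+-* b m (tri m)) ⟨
      b ^ tri (suc m) * d ^ suc m * pairProduct w L ∎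
      where
      open ≡-Reasoning
      d = degree w x L
      lemma : ∀ x d y e p → x * d * (y * e * p) ≡ x * y * (d * e) * p
      lemma = solve-∀

    two-classes : ∀ {x y} → w x y ≡ b → ∀ m n L → pairProduct w (replicate m x ++ replicate n y ++ L)
      ≡ b ^ tri m * (b ^ n * degree w x L) ^ m * (b ^ tri n * degree w y L ^ n * pairProduct w L)
    two-classes {x} {y} xy m n L = trans (pairProduct-replicate-++ m x _)
      (cong₂ (λ d p → b ^ tri m * d ^ m * p) (degree-replicate-++ xy n L) (pairProduct-replicate-++ n y L))

    -- Pairs inside the union of the two classes stay blue whichever vertex is copied, so only the
    -- degrees into `L` matter, and copying the vertex of larger degree cannot decrease the product.
    merge : ∀ {x y} → w x y ≡ b → ∀ m n L → ∃ λ z → (z ≡ x ⊎ z ≡ y) ×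
      pairProduct w (replicate m x ++ replicate n y ++ L) ≤ pairProduct w (replicate m z ++ replicate n z ++ L)
    merge {x} {y} xy m n L with ≤-total (degree w x L) (degree w y L)
    ... | inj₁ dx≤dy = y , inj₂ refl , subst₂ _≤_ (sym (two-classes xy m n L)) (sym (two-classes (diagonal y) m n L))
      (*-monoˡ-≤ (b ^ tri n * degree w y L ^ n * pairProduct w L) (*-monoʳ-≤ (b ^ tri m) (^-monoˡ-≤ m (*-monoʳ-≤ (b ^ n) dx≤dy))))
    ... | inj₂ dy≤dx = x , inj₁ refl , subst₂ _≤_ (sym (two-classes xy m n L)) (sym (two-classes (diagonal x) m n L))
      (*-monoʳ-≤ (b ^ tri m * (b ^ n * degree w x L) ^ m) (*-monoˡ-≤ (pairProduct w L) (*-monoʳ-≤ (b ^ tri n) (^-monoˡ-≤ n dy≤dx))))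

    gather : ∀ x L → ∃ λ m → ∃ λ R → x ∉ R × L ↭ replicate m x ++ R
    gather x []      = 0 , [] , (λ ()) , ↭-refl
    gather x (y ∷ L) with gather x L
    ... | m , R , x∉R , p with x ≟ⱽ y
    ... | yes refl = suc m , R , x∉R , prep x p
    ... | no x≢y   = m , y ∷ R , (λ { (here x≡y) → x≢y x≡y ; (there q) → x∉R q }) ,
                     ↭-trans (prep y p) (↭-sym (shift y (replicate m x) R))

    -- As the diagonal is blue, two occurrences of one vertex also count as a blue pair; merging
    -- therefore removes repetitions from `S` as well.
    blue-pair : ∀ S → AllPairs (λ x y → w x y ≢ b) S ⊎ (∃ λ x → ∃ λ y → ∃ λ S′ → w x y ≡ b × S ↭ x ∷ y ∷ S′)
    blue-pair [] = inj₁ []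
    blue-pair (s ∷ S) with ∃∈? (λ y → w s y ≟ b) S | blue-pair S
    ... | yes (y , y∈S , sy) | _ = let S′ , p = ∈⇒↭∷ y∈S in inj₂ (s , y , S′ , sy , prep s p)
    ... | no _  | inj₂ (x , y , S′ , xy , p) = inj₂ (x , y , s ∷ S′ , xy , ↭-trans (prep s p) (↭-sym (shift s (x ∷ y ∷ []) S′)))
    ... | no ∄y | inj₁ ps = inj₁ (All.tabulate (λ {y} y∈S sy → ∄y (y , y∈S , sy)) ∷ ps)

    -- Here `S` lists the vertices that may still occur in `L`. A merge replaces x and y in `S` by a
    -- single z, which makes `S` shorter, while `L` keeps its length.
    purify : ∀ S → Acc _<_ (length S) → ∀ L → (∀ {v} → v ∈ L → v ∈ S) →
             ∃ λ L′ → Pure L′ × length L′ ≡ length L × pairProduct w L ≤ pairProduct w L′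
    purify S (acc rec) L L⊆S with blue-pair S
    ... | inj₁ ps = L , pure , refl , ≤-refl
      where
      pure : Pure L
      pure {x} {y} x∈L y∈L xy with AllPairs-lookup ps (L⊆S x∈L) (L⊆S y∈L)
      ... | inj₁ x≡y       = x≡y
      ... | inj₂ (inj₁ ≢b) = contradiction xy ≢b
      ... | inj₂ (inj₂ ≢b) = contradiction (trans (symmetric y x) xy) ≢b
    ... | inj₂ (x , y , S′ , xy , S↭) with gather x L
    ... | m , L₁ , x∉L₁ , L↭ with gather y L₁
    ... | n , L₂ , y∉L₂ , L₁↭ with merge xy m n L₂
    ... | z , z≡ , le with purify (z ∷ S′) (rec shorter) L′ L′⊆
      where
      L′ = replicate m z ++ replicate n z ++ L₂
      shorter : length (z ∷ S′) < length S
      shorter = ≤-reflexive (sym (↭-length S↭))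
      L′⊆ : ∀ {v} → v ∈ L′ → v ∈ z ∷ S′
      L′⊆ v∈ with ∈-++⁻ (replicate m z) v∈
      ... | inj₁ v∈z = here (∈-replicate⁻ m v∈z)
      ... | inj₂ v∈′ with ∈-++⁻ (replicate n z) v∈′
      ... | inj₁ v∈z = here (∈-replicate⁻ n v∈z)
      ... | inj₂ v∈L₂ with ∈-resp-↭ S↭ (L⊆S (∈-resp-↭ (↭-sym L↭) (∈-++⁺ʳ (replicate m x) v∈L₁)))
        where v∈L₁ = ∈-resp-↭ (↭-sym L₁↭) (∈-++⁺ʳ (replicate n y) v∈L₂)
      ... | here refl         = contradiction (∈-resp-↭ (↭-sym L₁↭) (∈-++⁺ʳ (replicate n y) v∈L₂)) x∉L₁
      ... | there (here refl) = contradiction v∈L₂ y∉L₂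
      ... | there (there v∈S) = there v∈S
    ... | L″ , pure , len , le′ = L″ , pure , trans len len′ , ≤-trans (≤-reflexive (pairProduct-↭ symmetric L↭′)) (≤-trans le le′)
      where
      L↭′ : L ↭ replicate m x ++ replicate n y ++ L₂
      L↭′ = ↭-trans L↭ (Permₚ.++⁺ˡ (replicate m x) L₁↭)
      length-classes : ∀ x y → length (replicate m x ++ replicate n y ++ L₂) ≡ m + (n + length L₂)
      length-classes x y = trans (length-++ (replicate m x)) (cong₂ _+_ (length-replicate m)
        (trans (length-++ (replicate n y)) (cong (_+ length L₂) (length-replicate n))))
      len′ : length (replicate m z ++ replicate n z ++ L₂) ≡ length L
      len′ = trans (length-classes z z) (sym (trans (↭-length L↭′) (length-classes x y)))

    pure-⊆ : ∀ {L L′} → (∀ {v} → v ∈ L′ → v ∈ L) → Pure L → Pure L′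
    pure-⊆ L′⊆L pure x∈ y∈ = pure (L′⊆L x∈) (L′⊆L y∈)

    -- Star forests

    -- That x and t differ follows, as x ≡ t would give a red triangle.
    Path₄ : List V → Set
    Path₄ L = ∃ λ x → x ∈ L × ∃ λ y → y ∈ L × ∃ λ z → z ∈ L × ∃ λ t → t ∈ L ×
      Red x y × Red y z × Red z t × x ≢ z × y ≢ t

    path₄? : ∀ L → Dec (Path₄ L)
    path₄? L = ∃∈? (λ x → ∃∈? (λ y → ∃∈? (λ z → ∃∈? (λ t →
      red? x y ×-dec red? y z ×-dec red? z t ×-dec ¬? (x ≟ⱽ z) ×-dec ¬? (y ≟ⱽ t)) L) L) L) L

    path₄-⊆ : ∀ {L L′} → (∀ {v} → v ∈ L′ → v ∈ L) → Path₄ L′ → Path₄ L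
    path₄-⊆ ⊆ (x , x∈ , y , y∈ , z , z∈ , t , t∈ , p) = x , ⊆ x∈ , y , ⊆ y∈ , z , ⊆ z∈ , t , ⊆ t∈ , p

    multiplicity : V → List V → ℕ
    multiplicity v L = length (filter (v ≟ⱽ_) L)

    multiplicity-↭ : ∀ v {L L′} → L ↭ L′ → multiplicity v L ≡ multiplicity v L′
    multiplicity-↭ v p = ↭-length (filter-↭ (v ≟ⱽ_) p)

    multiplicity-∷ : ∀ v x L → multiplicity v L ≤ multiplicity v (x ∷ L)
    multiplicity-∷ v x L with v ≟ⱽ x
    ... | yes _ = n≤1+n _
    ... | no  _ = ≤-refl

    multiplicity-replicate-++ : ∀ m x L → multiplicity x (replicate m x ++ L) ≡ m + multiplicity x L
    multiplicity-replicate-++ zero    x L = refl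
    multiplicity-replicate-++ (suc m) x L =
      trans (cong length (filter-accept (x ≟ⱽ_) refl)) (cong suc (multiplicity-replicate-++ m x L))

    multiplicity-∉ : ∀ {x} L → x ∉ L → multiplicity x L ≡ 0
    multiplicity-∉ []      x∉L = refl
    multiplicity-∉ (y ∷ L) x∉L = trans (cong length (filter-reject (_ ≟ⱽ_) (λ x≡y → x∉L (here x≡y)))) (multiplicity-∉ L (λ p → x∉L (there p)))

    -- The only possible red neighbour is u, which may have several copies in `L`. Vertices without
    -- red neighbours are included; for them u is arbitrary.
    Leaf : List V → V → Set
    Leaf L v = ∃ λ u → ∀ {z} → z ∈ L → z ≡ u ⊎ w v z ≤ a

    leaf-or-branch : ∀ L v → Leaf L v ⊎ (∃ λ x → ∃ λ y → x ∈ L × y ∈ L × Red v x × Red v y × x ≢ y)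
    leaf-or-branch L v with ∃∈? (λ x → ∃∈? (λ y → red? v x ×-dec red? v y ×-dec ¬? (x ≟ⱽ y)) L) L
    ... | yes (x , x∈ , y , y∈ , p) = inj₂ (x , y , x∈ , y∈ , p)
    ... | no ∄ with ∃∈? (red? v) L
    ... | no ∄red = inj₁ (v , λ {z} z∈ → inj₂ (¬red⇒≤a (λ vz → ∄red (z , z∈ , vz))))
    ... | yes (u , u∈ , vu) = inj₁ (u , only-u)
      where
      only-u : ∀ {z} → z ∈ L → z ≡ u ⊎ w v z ≤ a
      only-u {z} z∈ with red? v z
      ... | no ¬vz = inj₂ (¬red⇒≤a ¬vz)
      ... | yes vz with z ≟ⱽ u
      ... | yes z≡u = inj₁ z≡u
      ... | no  z≢u = contradiction (z , z∈ , u , u∈ , vz , vu , z≢u) ∄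

    degree-leaf : ∀ v u L → All (λ z → z ≡ u ⊎ w v z ≤ a) L →
      degree w v L * a ^ multiplicity u L ≤ a ^ length L * r ^ multiplicity u L
    degree-leaf v u []      []       = ≤-refl
    degree-leaf v u (z ∷ L) (p ∷ ps) with u ≟ⱽ z
    ... | yes refl = begin
      w v z * degree w v L * (a * a ^ m)      ≡⟨ lemma (w v z) (degree w v L) a (a ^ m) ⟩
      w v z * a * (degree w v L * a ^ m)      ≤⟨ *-mono-≤ (*-monoˡ-≤ a (≤r v z)) (degree-leaf v z L ps) ⟩
      r * a * (a ^ length L * r ^ m)          ≡⟨ lemma′ r a (a ^ length L) (r ^ m) ⟩
      a * a ^ length L * (r * r ^ m)          ∎
      where
      open ≤-Reasoning
      m = multiplicity z L
      lemma : ∀ x d a y → x * d * (a * y) ≡ x * a * (d * y)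
      lemma = solve-∀
      lemma′ : ∀ r a x y → r * a * (x * y) ≡ a * x * (r * y)
      lemma′ = solve-∀
    ... | no u≢z = begin
      w v z * degree w v L * a ^ m            ≡⟨ *-assoc (w v z) (degree w v L) (a ^ m) ⟩
      w v z * (degree w v L * a ^ m)          ≤⟨ *-mono-≤ (≤a p) (degree-leaf v u L ps) ⟩
      a * (a ^ length L * r ^ m)              ≡⟨ *-assoc a (a ^ length L) (r ^ m) ⟨
      a * a ^ length L * r ^ m                ∎
      where
      open ≤-Reasoning
      m = multiplicity u L
      ≤a : z ≡ u ⊎ w v z ≤ a → w v z ≤ a
      ≤a (inj₁ z≡u) = contradiction (sym z≡u) u≢z
      ≤a (inj₂ ≤a)  = ≤a

    -- At most M entries are red to v, and the bound is exactly the factor by which `T M l` grows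
    -- when V_1 gains a vertex.
    degree-leaf′ : ∀ {v u L M l} → All (λ z → z ≡ u ⊎ w v z ≤ a) L → multiplicity u L ≤ M → length L ≡ M + l →
      degree w v L ≤ a ^ l * r ^ M
    degree-leaf′ {v} {u} {L} {M} {l} ps m≤M len =
      *-cancelʳ-≤ _ _ (a ^ M * a ^ m) {{m*n≢0 (a ^ M) (a ^ m) {{m^n≢0 a M}} {{m^n≢0 a m}}}} (begin
      d * (a ^ M * a ^ m)                     ≡⟨ lemma d (a ^ M) (a ^ m) ⟩
      d * a ^ m * a ^ M                       ≤⟨ *-monoˡ-≤ (a ^ M) (degree-leaf v u L ps) ⟩
      a ^ length L * r ^ m * a ^ M            ≡⟨ *-assoc (a ^ length L) (r ^ m) (a ^ M) ⟩
      a ^ length L * (r ^ m * a ^ M)          ≤⟨ *-monoʳ-≤ (a ^ length L) (ratio-mono m≤M) ⟩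
      a ^ length L * (a ^ m * r ^ M)          ≡⟨ cong (_* (a ^ m * r ^ M)) (trans (cong (a ^_) len) (^-distribˡ-+-* a M l)) ⟩
      a ^ M * a ^ l * (a ^ m * r ^ M)         ≡⟨ lemma′ (a ^ M) (a ^ l) (a ^ m) (r ^ M) ⟩
      a ^ l * r ^ M * (a ^ M * a ^ m)         ∎)
      where
      open ≤-Reasoning
      d = degree w v L
      m = multiplicity u L
      lemma : ∀ d x y → d * (x * y) ≡ d * y * x
      lemma = solve-∀
      lemma′ : ∀ x y z t → x * y * (z * t) ≡ y * t * (x * z)
      lemma′ = solve-∀

    -- A longest red path has at most three vertices, so one of its ends is a leaf other than c.
    other-leaf : ∀ {c L v} → ¬ Path₄ L → v ∈ L → v ≢ c → ∃ λ y → y ∈ L × y ≢ c × Leaf L y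
    other-leaf {c} {L} {v} ¬path v∈ v≢c with leaf-or-branch L v
    ... | inj₁ leaf = v , v∈ , v≢c , leaf
    ... | inj₂ (x , y , x∈ , y∈ , vx , vy , x≢y) = choose (y ≟ⱽ c)
      where
      end-leaf : ∀ {x y} → x ∈ L → y ∈ L → Red v x → Red v y → x ≢ y → Leaf L y
      end-leaf {x} {y} x∈ y∈ vx vy x≢y with leaf-or-branch L y
      ... | inj₁ leaf = leaf
      ... | inj₂ (p , q , p∈ , q∈ , yp , yq , p≢q) with v ≟ⱽ p
      ... | no  v≢p  = contradiction (x , x∈ , v , v∈ , y , y∈ , p , p∈ , red-sym vx , vy , yp , x≢y , v≢p) ¬path
      ... | yes refl = contradiction (x , x∈ , v , v∈ , y , y∈ , q , q∈ , red-sym vx , vy , yq , x≢y , p≢q) ¬path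
      choose : Dec (y ≡ c) → ∃ λ y → y ∈ L × y ≢ c × Leaf L y
      choose (no y≢c)   = y , y∈ , y≢c , end-leaf x∈ y∈ vx vy x≢y
      choose (yes refl) = x , x∈ , x≢y , end-leaf y∈ x∈ vy vx (λ y≡x → x≢y (sym y≡x))

    -- Peels off single copies of leaves outside the class of c. Each costs no more than a vertex of
    -- V_1, whichever class its red neighbours form, because no class has more than M members. In
    -- the end only the M mutually blue copies of c are left.
    star-forest : ∀ c M R → Acc _<_ (length R) → c ∉ R → ¬ Path₄ (replicate M c ++ R) →
      (∀ v → multiplicity v (replicate M c ++ R) ≤ M) → pairProduct w (replicate M c ++ R) ≤ T M (length R)
    star-forest c M [] _ _ _ _ = ≤-reflexive (begin
      pairProduct w (replicate M c ++ [])                   ≡⟨ pairProduct-replicate-++ M c [] ⟩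
      b ^ tri M * 1 ^ M * 1                                 ≡⟨ cong (λ z → b ^ tri M * z * 1) (^-zeroˡ M) ⟩
      b ^ tri M * 1 * 1                                     ≡⟨ cong (λ z → b ^ tri M * 1 * r ^ z) (*-zeroʳ M) ⟨
      T M 0                                                 ∎)
      where open ≡-Reasoning
    star-forest c M R@(v ∷ _) (acc rec) c∉R ¬path mult
      with other-leaf {c} ¬path (∈-++⁺ʳ (replicate M c) (here refl)) (λ v≡c → c∉R (here (sym v≡c)))
    ... | y , y∈ , y≢c , u , y-leaf with ∈-++⁻ (replicate M c) y∈
    ... | inj₁ y∈c = contradiction (∈-replicate⁻ M y∈c) y≢c
    ... | inj₂ y∈R with ∈⇒↭∷ y∈R
    ... | R′ , R↭ = begin
      pairProduct w (replicate M c ++ R)               ≡⟨ pairProduct-↭ symmetric L↭ ⟩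
      pairProduct w (y ∷ L′)                           ≡⟨ pairProduct-∷ w y L′ ⟩
      degree w y L′ * pairProduct w L′                 ≤⟨ *-mono-≤ degree≤ smaller ⟩
      a ^ length R′ * r ^ M * T M (length R′)          ≡⟨ *-comm _ (T M (length R′)) ⟩
      T M (length R′) * (a ^ length R′ * r ^ M)        ≡⟨ T-sucʳ M (length R′) ⟨
      T M (suc (length R′))                            ≡⟨ cong (T M) (↭-length R↭) ⟨
      T M (length R)                                   ∎
      where
      open ≤-Reasoning
      L′ = replicate M c ++ R′
      L↭ : replicate M c ++ R ↭ y ∷ L′
      L↭ = ↭-trans (Permₚ.++⁺ˡ (replicate M c) R↭) (shift y (replicate M c) R′)
      L′⊆L : ∀ {z} → z ∈ L′ → z ∈ replicate M c ++ R
      L′⊆L z∈ = ∈-resp-↭ (↭-sym L↭) (there z∈)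
      mult′ : ∀ z → multiplicity z L′ ≤ M
      mult′ z = ≤-trans (multiplicity-∷ z y L′) (≤-trans (≤-reflexive (sym (multiplicity-↭ z L↭))) (mult z))
      degree≤ : degree w y L′ ≤ a ^ length R′ * r ^ M
      degree≤ = degree-leaf′ {u = u} (All.tabulate (λ z∈ → y-leaf (L′⊆L z∈))) (mult′ u)
        (trans (length-++ (replicate M c)) (cong (_+ length R′) (length-replicate M)))
      smaller : pairProduct w L′ ≤ T M (length R′)
      smaller = star-forest c M R′ (rec (≤-reflexive (sym (↭-length R↭)))) (λ c∈R′ → c∉R (∈-resp-↭ (↭-sym R↭) (there c∈R′)))
        (λ p → ¬path (path₄-⊆ L′⊆L p)) mult′

    no-path₄ : ∀ L → ¬ Path₄ L → T-bounded (length L) (pairProduct w L)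
    no-path₄ [] _ = 0 , 0 , refl , ≤-refl
    no-path₄ L@(x ∷ L₀) ¬path with gather c L
      where c = argmax (λ v → multiplicity v L) x L₀
    ... | M , R , c∉R , L↭ = M , length R , len , ≤-trans (≤-reflexive (pairProduct-↭ symmetric L↭))
          (star-forest c M R (<-wellFounded _) c∉R (λ p → ¬path (path₄-⊆ (∈-resp-↭ (↭-sym L↭)) p)) mult)
      where
      c = argmax (λ v → multiplicity v L) x L₀
      len : M + length R ≡ length L
      len = sym (trans (↭-length L↭) (trans (length-++ (replicate M c)) (cong (_+ length R) (length-replicate M))))
      M≡ : multiplicity c L ≡ M
      M≡ = trans (multiplicity-↭ c L↭) (trans (multiplicity-replicate-++ M c R) (trans (cong (M +_) (multiplicity-∉ R c∉R)) (+-identityʳ M)))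
      most : ∀ {v} → v ∈ L → multiplicity v L ≤ multiplicity c L
      most (here refl) = f[⊥]≤f[argmax] {f = λ v → multiplicity v L} x L₀
      most (there v∈)  = All.lookup (f[xs]≤f[argmax] {f = λ v → multiplicity v L} x L₀) v∈
      mult : ∀ v → multiplicity v (replicate M c ++ R) ≤ M
      mult v with ∃∈? (v ≟ⱽ_) L
      ... | yes (_ , v∈ , refl) = ≤-trans (≤-reflexive (sym (multiplicity-↭ v L↭))) (≤-trans (most v∈) (≤-reflexive M≡))
      ... | no ∄v = ≤-trans (≤-reflexive (trans (sym (multiplicity-↭ v L↭)) (multiplicity-∉ L (λ v∈ → ∄v (v , v∈ , refl))))) z≤n

    -- Short paths and cycles

    productTo-almost : ∀ v s S → AllPairs (λ x y → ¬ (Red x v × Red y v)) (s ∷ S) → productTo w (s ∷ S) v ≤ almost (length S)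
    productTo-almost v s S (p ∷ ps) with red? s v
    ... | yes sv = ≤-trans (*-mono-≤ (≤r s v) (product-map-≤-^ (All.map (λ ¬both → ¬red⇒≤a (λ xv → ¬both (sv , xv))) p)))
                           (≤-reflexive (almost≡ (length S)))
    productTo-almost v s []      _        | no ¬sv = ≤-trans (≤-reflexive (*-identityʳ _)) (≤r s v)
    productTo-almost v s (t ∷ S) (_ ∷ ps) | no ¬sv = *-mono-≤ (¬red⇒≤a ¬sv) (productTo-almost v t S ps)

    chord : ∀ {x y z} → Red x y → Red y z → w x z ≤ a
    chord xy yz = ¬red⇒≤a (λ xz → triangle xy yz (red-sym xz))

    edge-≁ : ∀ {x y v} → Red x y → ¬ (Red x v × Red y v)
    edge-≁ xy (xv , yv) = triangle xy yv (red-sym xv)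

    -- A second common neighbour would close a red 4-cycle, and in a pure list its blue diagonal has
    -- equal ends. Together with `triangle` this gives red girth at least 5.
    common-neighbour : ∀ {L x y z v} → Pure L → x ∈ L → y ∈ L → z ∈ L → v ∈ L → x ≢ z →
      Red x y → Red y z → Red x v × Red z v → v ≡ y
    common-neighbour pure x∈ y∈ z∈ v∈ x≢z xy yz (xv , zv) with four-cycle xy yz zv (red-sym xv)
    ... | inj₁ xz = contradiction (pure x∈ z∈ xz) x≢z
    ... | inj₂ yv = sym (pure y∈ v∈ yv)

    Cycle₅ : List V → Set
    Cycle₅ L = ∃ λ x → x ∈ L × ∃ λ y → y ∈ L × ∃ λ z → z ∈ L × ∃ λ t → t ∈ L × ∃ λ u → u ∈ L ×
      Red x y × Red y z × Red z t × Red t u × Red u x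

    cycle₅? : ∀ L → Dec (Cycle₅ L)
    cycle₅? L = ∃∈? (λ x → ∃∈? (λ y → ∃∈? (λ z → ∃∈? (λ t → ∃∈? (λ u →
      red? x y ×-dec red? y z ×-dec red? z t ×-dec red? t u ×-dec red? u x) L) L) L) L) L

    cycle₅-⊆ : ∀ {L L′} → (∀ {v} → v ∈ L′ → v ∈ L) → Cycle₅ L′ → Cycle₅ L
    cycle₅-⊆ ⊆ (x , x∈ , y , y∈ , z , z∈ , t , t∈ , u , u∈ , p) =
      x , ⊆ x∈ , y , ⊆ y∈ , z , ⊆ z∈ , t , ⊆ t∈ , u , ⊆ u∈ , p

    -- `C` accounts for the pairs inside the t deleted vertices, `K` for the pairs from all of them
    -- to one remaining vertex.
    Removable : (t C K : ℕ) → List V → Set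
    Removable t C K L = ∃ λ L′ → length L ≡ t + length L′ × (∀ {v} → v ∈ L′ → v ∈ L) ×
      pairProduct w L ≤ C * K ^ length L′ * pairProduct w L′

    -- The remainder may contain clones of the path. A clone of an end meets the bound by b ≤ a; a
    -- clone of an inner vertex is red to two path vertices and needs b r ≤ a a. Any other vertex is
    -- red to at most one of the four: two at distance 1, 2 or 3 would give a red triangle, 4-cycle
    -- or 5-cycle.
    remove-path : ∀ {L} → Pure L → ¬ Cycle₅ L → Path₄ L →
      Removable 4 (a * a * a * (r * r * r)) (a * (a * (a * r))) L
    remove-path {L} pure ¬cycle (x , x∈ , y , y∈ , z , z∈ , t , t∈ , xy , yz , zt , x≢z , y≢t)
      with extract {S = x ∷ y ∷ z ∷ t ∷ []}
             ((red⇒≢ xy ∷ x≢z ∷ x≢t ∷ []) ∷ (red⇒≢ yz ∷ y≢t ∷ []) ∷ (red⇒≢ zt ∷ []) ∷ [] ∷ [])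
             (x∈ ∷ y∈ ∷ z∈ ∷ t∈ ∷ [])
      where
      x≢t : x ≢ t
      x≢t refl = triangle xy yz zt
    ... | L′ , L↭ = L′ , ↭-length L↭ , (λ v∈ → ∈-resp-↭ (↭-sym L↭) (∈-++⁺ʳ S v∈)) ,
      (begin
        pairProduct w L
          ≡⟨ pairProduct-↭ symmetric L↭ ⟩
        pairProduct w (S ++ L′)
          ≤⟨ pairProduct-++-≤ w S (All.tabulate (λ v∈ → outside (∈-resp-↭ (↭-sym L↭) (∈-++⁺ʳ S v∈)))) ⟩
        pairProduct w S * (a * (a * (a * r))) ^ length L′ * pairProduct w L′
          ≤⟨ *-monoˡ-≤ (pairProduct w L′) (*-monoˡ-≤ ((a * (a * (a * r))) ^ length L′) inside) ⟩
        a * a * a * (r * r * r) * (a * (a * (a * r))) ^ length L′ * pairProduct w L′ ∎)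
      where
      open ≤-Reasoning
      S = x ∷ y ∷ z ∷ t ∷ []
      -- A red xt would close a 4-cycle, whose blue diagonal would identify x with z or y with t.
      xt≤a : w x t ≤ a
      xt≤a = ¬red⇒≤a (λ xt → [ (λ xz → x≢z (pure x∈ z∈ xz)) , (λ yt → y≢t (pure y∈ t∈ yt)) ]′ (four-cycle xy yz zt (red-sym xt)))
      flip : ∀ {x y n} → w x y ≤ n → w y x ≤ n
      flip {x} {y} = subst (_≤ _) (symmetric x y)
      inside : pairProduct w S ≤ a * a * a * (r * r * r)
      inside = ≤-trans
        (*-mono-≤ (≤r x y) (*-mono-≤ (chord xy yz) (*-mono-≤ xt≤a (*-mono-≤ (≤r y z) (*-mono-≤ (chord yz zt) (*-mono-≤ (≤r z t) (≤-refl {1})))))))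
        (≤-reflexive (lemma a r))
        where
        lemma : ∀ a r → r * (a * (a * (r * (a * (r * 1))))) ≡ a * a * a * (r * r * r)
        lemma = solve-∀
      blue≤ : ∀ v → w v v ≤ b
      blue≤ v = ≤-reflexive (diagonal v)
      outside : ∀ {v} → v ∈ L → productTo w S v ≤ a * (a * (a * r))
      outside {v} v∈ with v ≟ⱽ x
      ... | yes refl = ≤-trans (*-mono-≤ (≤-trans (blue≤ x) b≤a) (*-mono-≤ (≤r y x) (*-mono-≤ (flip (chord xy yz)) (*-mono-≤ (flip xt≤a) (≤-refl {1})))))
                               (≤-reflexive (lemma a r))
        where
        lemma : ∀ a r → a * (r * (a * (a * 1))) ≡ a * (a * (a * r))
        lemma = solve-∀
      ... | no v≢x with v ≟ⱽ t
      ... | yes refl = ≤-trans (*-mono-≤ xt≤a (*-mono-≤ (chord yz zt) (*-mono-≤ (≤r z t) (*-mono-≤ (≤-trans (blue≤ t) b≤a) (≤-refl {1})))))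
                               (≤-reflexive (lemma a r))
        where
        lemma : ∀ a r → a * (a * (r * (a * 1))) ≡ a * (a * (a * r))
        lemma = solve-∀
      ... | no v≢t with v ≟ⱽ y
      ... | yes refl = begin
          productTo w S y                   ≤⟨ *-mono-≤ (≤r x y) (*-mono-≤ (blue≤ y) (*-mono-≤ (≤r z y) (*-mono-≤ (flip (chord yz zt)) (≤-refl {1})))) ⟩
          r * (b * (r * (a * 1)))    ≡⟨ lemma b a r ⟩
          b * r * (a * r)            ≤⟨ *-monoˡ-≤ (a * r) br≤aa ⟩
          a * a * (a * r)            ≡⟨ *-assoc a a (a * r) ⟩
          a * (a * (a * r))          ∎
        where
        lemma : ∀ b a r → r * (b * (r * (a * 1))) ≡ b * r * (a * r)
        lemma = solve-∀
      ... | no v≢y with v ≟ⱽ z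
      ... | yes refl = begin
          productTo w S z                   ≤⟨ *-mono-≤ (chord xy yz) (*-mono-≤ (≤r y z) (*-mono-≤ (blue≤ z) (*-mono-≤ (≤r t z) (≤-refl {1})))) ⟩
          a * (r * (b * (r * 1)))    ≡⟨ lemma b a r ⟩
          b * r * (a * r)            ≤⟨ *-monoˡ-≤ (a * r) br≤aa ⟩
          a * a * (a * r)            ≡⟨ *-assoc a a (a * r) ⟩
          a * (a * (a * r))          ∎
        where
        lemma : ∀ b a r → a * (r * (b * (r * 1))) ≡ b * r * (a * r)
        lemma = solve-∀
      ... | no v≢z = productTo-almost v x (y ∷ z ∷ t ∷ [])
        ( (edge-≁ xy ∷ (λ p → v≢y (common-neighbour pure x∈ y∈ z∈ v∈ x≢z xy yz p))
                     ∷ (λ { (xv , tv) → ¬cycle (x , x∈ , y , y∈ , z , z∈ , t , t∈ , v , v∈ , xy , yz , zt , tv , red-sym xv) }) ∷ [])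
        ∷ (edge-≁ yz ∷ (λ p → v≢z (common-neighbour pure y∈ z∈ t∈ v∈ y≢t yz zt p)) ∷ [])
        ∷ (edge-≁ zt ∷ [])
        ∷ [] ∷ [])

    -- Every cycle vertex has two red neighbours on the cycle, so all clones are paid for by b r ≤ a
    -- a. Any two cycle vertices are at distance 1 or 2, so a further vertex red to both would give
    -- a red triangle or 4-cycle.
    remove-cycle : ∀ {L} → Pure L → Cycle₅ L →
      Removable 5 (a * a * a * a * a * (r * r * r * r * r)) (a * (a * (a * (a * r)))) L
    remove-cycle {L} pure (x , x∈ , y , y∈ , z , z∈ , t , t∈ , u , u∈ , xy , yz , zt , tu , ux)
      with extract {S = x ∷ y ∷ z ∷ t ∷ u ∷ []}
             ((red⇒≢ xy ∷ skip xy yz zt tu ux ∷ ≢-sym (skip tu ux xy yz zt) ∷ ≢-sym (red⇒≢ ux) ∷ [])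
             ∷ (red⇒≢ yz ∷ skip yz zt tu ux xy ∷ ≢-sym (skip ux xy yz zt tu) ∷ [])
             ∷ (red⇒≢ zt ∷ skip zt tu ux xy yz ∷ []) ∷ (red⇒≢ tu ∷ []) ∷ [] ∷ [])
             (x∈ ∷ y∈ ∷ z∈ ∷ t∈ ∷ u∈ ∷ [])
      where
      skip : ∀ {x y z t u} → Red x y → Red y z → Red z t → Red t u → Red u x → x ≢ z
      skip _ _ zt tu ux refl = triangle zt tu ux
    ... | L′ , L↭ = L′ , ↭-length L↭ , (λ v∈ → ∈-resp-↭ (↭-sym L↭) (∈-++⁺ʳ S v∈)) ,
      (begin
        pairProduct w L
          ≡⟨ pairProduct-↭ symmetric L↭ ⟩
        pairProduct w (S ++ L′)
          ≤⟨ pairProduct-++-≤ w S (All.tabulate (λ v∈ → outside (∈-resp-↭ (↭-sym L↭) (∈-++⁺ʳ S v∈)))) ⟩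
        pairProduct w S * (a * (a * (a * (a * r)))) ^ length L′ * pairProduct w L′
          ≤⟨ *-monoˡ-≤ (pairProduct w L′) (*-monoˡ-≤ ((a * (a * (a * (a * r)))) ^ length L′) inside) ⟩
        a * a * a * a * a * (r * r * r * r * r) * (a * (a * (a * (a * r)))) ^ length L′ * pairProduct w L′ ∎)
      where
      open ≤-Reasoning
      S = x ∷ y ∷ z ∷ t ∷ u ∷ []
      skip : ∀ {x y z t u} → Red x y → Red y z → Red z t → Red t u → Red u x → x ≢ z
      skip _ _ zt tu ux refl = triangle zt tu ux
      flip : ∀ {x y n} → w x y ≤ n → w y x ≤ n
      flip {x} {y} = subst (_≤ _) (symmetric x y)
      inside : pairProduct w S ≤ a * a * a * a * a * (r * r * r * r * r)
      inside = ≤-trans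
        (*-mono-≤ (≤r x y) (*-mono-≤ (chord xy yz) (*-mono-≤ (flip (chord tu ux)) (*-mono-≤ (≤r x u)
        (*-mono-≤ (≤r y z) (*-mono-≤ (chord yz zt) (*-mono-≤ (flip (chord ux xy))
        (*-mono-≤ (≤r z t) (*-mono-≤ (chord zt tu)
        (*-mono-≤ (≤r t u) (≤-refl {1})))))))))))
        (≤-reflexive (lemma a r))
        where
        lemma : ∀ a r → r * (a * (a * (r * (r * (a * (a * (r * (a * (r * 1))))))))) ≡ a * a * a * a * a * (r * r * r * r * r)
        lemma = solve-∀
      blue≤ : ∀ v → w v v ≤ b
      blue≤ v = ≤-reflexive (diagonal v)
      clone : b * (r * r) * (a * a) ≤ a * (a * (a * (a * r)))
      clone = ≤-trans (≤-reflexive (lemma b a r)) (≤-trans (*-monoˡ-≤ (a * a * r) br≤aa) (≤-reflexive (lemma′ a r)))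
        where
        lemma : ∀ b a r → b * (r * r) * (a * a) ≡ b * r * (a * a * r)
        lemma = solve-∀
        lemma′ : ∀ a r → a * a * (a * a * r) ≡ a * (a * (a * (a * r)))
        lemma′ = solve-∀
      outside : ∀ {v} → v ∈ L → productTo w S v ≤ a * (a * (a * (a * r)))
      outside {v} v∈ with v ≟ⱽ x
      ... | yes refl = ≤-trans (*-mono-≤ (blue≤ x) (*-mono-≤ (≤r y x) (*-mono-≤ (flip (chord xy yz)) (*-mono-≤ (chord tu ux) (*-mono-≤ (≤r u x) (≤-refl {1}))))))
                               (≤-trans (≤-reflexive (lemma b a r)) clone)
        where
        lemma : ∀ b a r → b * (r * (a * (a * (r * 1)))) ≡ b * (r * r) * (a * a)
        lemma = solve-∀
      ... | no v≢x with v ≟ⱽ y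
      ... | yes refl = ≤-trans (*-mono-≤ (≤r x y) (*-mono-≤ (blue≤ y) (*-mono-≤ (≤r z y) (*-mono-≤ (flip (chord yz zt)) (*-mono-≤ (chord ux xy) (≤-refl {1}))))))
                               (≤-trans (≤-reflexive (lemma b a r)) clone)
        where
        lemma : ∀ b a r → r * (b * (r * (a * (a * 1)))) ≡ b * (r * r) * (a * a)
        lemma = solve-∀
      ... | no v≢y with v ≟ⱽ z
      ... | yes refl = ≤-trans (*-mono-≤ (chord xy yz) (*-mono-≤ (≤r y z) (*-mono-≤ (blue≤ z) (*-mono-≤ (≤r t z) (*-mono-≤ (flip (chord zt tu)) (≤-refl {1}))))))
                               (≤-trans (≤-reflexive (lemma b a r)) clone)
        where
        lemma : ∀ b a r → a * (r * (b * (r * (a * 1)))) ≡ b * (r * r) * (a * a)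
        lemma = solve-∀
      ... | no v≢z with v ≟ⱽ t
      ... | yes refl = ≤-trans (*-mono-≤ (flip (chord tu ux)) (*-mono-≤ (chord yz zt) (*-mono-≤ (≤r z t) (*-mono-≤ (blue≤ t) (*-mono-≤ (≤r u t) (≤-refl {1}))))))
                               (≤-trans (≤-reflexive (lemma b a r)) clone)
        where
        lemma : ∀ b a r → a * (a * (r * (b * (r * 1)))) ≡ b * (r * r) * (a * a)
        lemma = solve-∀
      ... | no v≢t with v ≟ⱽ u
      ... | yes refl = ≤-trans (*-mono-≤ (≤r x u) (*-mono-≤ (flip (chord ux xy)) (*-mono-≤ (chord zt tu) (*-mono-≤ (≤r t u) (*-mono-≤ (blue≤ u) (≤-refl {1}))))))
                               (≤-trans (≤-reflexive (lemma b a r)) clone)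
        where
        lemma : ∀ b a r → r * (a * (a * (r * (b * 1)))) ≡ b * (r * r) * (a * a)
        lemma = solve-∀
      ... | no v≢u = productTo-almost v x (y ∷ z ∷ t ∷ u ∷ [])
        ( (edge-≁ xy ∷ (λ p → v≢y (common-neighbour pure x∈ y∈ z∈ v∈ (skip xy yz zt tu ux) xy yz p))
                     ∷ (λ { (xv , tv) → v≢u (common-neighbour pure t∈ u∈ x∈ v∈ (skip tu ux xy yz zt) tu ux (tv , xv)) })
                     ∷ (λ { (xv , uv) → edge-≁ ux (uv , xv) }) ∷ [])
        ∷ (edge-≁ yz ∷ (λ p → v≢z (common-neighbour pure y∈ z∈ t∈ v∈ (skip yz zt tu ux xy) yz zt p))
                     ∷ (λ { (yv , uv) → v≢x (common-neighbour pure u∈ x∈ y∈ v∈ (skip ux xy yz zt tu) ux xy (uv , yv)) }) ∷ [])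
        ∷ (edge-≁ zt ∷ (λ p → v≢t (common-neighbour pure z∈ t∈ u∈ v∈ (skip zt tu ux xy yz) zt tu p)) ∷ [])
        ∷ (edge-≁ tu ∷ [])
        ∷ [] ∷ [])

    no-cycle₅ : ∀ L → Acc _<_ (length L) → Pure L → ¬ Cycle₅ L → T-bounded (length L) (pairProduct w L)
    no-cycle₅ L (acc rec) pure ¬cycle with path₄? L
    ... | no ¬path = no-path₄ L ¬path
    ... | yes path = shrink (remove-path pure ¬cycle path)
      where
      shrink : Removable 4 (a * a * a * (r * r * r)) (a * (a * (a * r))) L → T-bounded (length L) (pairProduct w L)
      shrink (L′ , len , L′⊆L , le) = subst (λ n → T-bounded n (pairProduct w L)) (sym len)
        (remove₄ {length L′} {pairProduct w L′} (no-cycle₅ L′ (rec shorter) (pure-⊆ L′⊆L pure) (λ c → ¬cycle (cycle₅-⊆ L′⊆L c))) le)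
        where
        shorter : length L′ < length L
        shorter = subst (length L′ <_) (sym len) (s≤s (m≤n+m (length L′) 3))

    -- Deleting a 5-cycle from a longer list absorbs whatever defect the rest has, so the defect
    -- survives only if the 5-cycle is the whole list.
    pure-bounded : ∀ L → Acc _<_ (length L) → 0 < length L → Pure L → Bounded (length L) (pairProduct w L)
    pure-bounded L (acc rec) 0<n pure with cycle₅? L
    ... | no ¬cycle = T-bounded⇒Bounded 0<n (no-cycle₅ L (<-wellFounded _) pure ¬cycle)
    ... | yes cycle = shrink (remove-cycle pure cycle)
      where
      C = a * a * a * a * a * (r * r * r * r * r)
      shrink : Removable 5 C (a * (a * (a * (a * r)))) L → Bounded (length L) (pairProduct w L)
      shrink ([] , len , _ , le) = subst (λ n → Bounded n (pairProduct w L)) (sym len)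
        (cycle-bounded (≤-trans le (≤-reflexive (trans (*-identityʳ (C * 1)) (*-identityʳ C)))))
      shrink (L′@(_ ∷ _) , len , L′⊆L , le) = T-bounded⇒Bounded 0<n (subst (λ n → T-bounded n (pairProduct w L)) (sym len)
        (remove₅ {length L′} {pairProduct w L′} (pure-bounded L′ (rec shorter) (s≤s z≤n) (pure-⊆ L′⊆L pure)) le))
        where
        shorter : length L′ < length L
        shorter = subst (length L′ <_) (sym len) (s≤s (m≤n+m (length L′) 4))

    nice-bounded : ∀ L → 0 < length L → Bounded (length L) (pairProduct w L)
    nice-bounded L 0<n with purify L (<-wellFounded _) L (λ v∈ → v∈)
    ... | L′ , pure , len , le with subst (λ n → Bounded n (pairProduct w L′)) len (pure-bounded L′ (<-wellFounded _) (subst (0 <_) (sym len) 0<n) pure)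
    ... | k , l , k+l≡n , δ<k , h = k , l , k+l≡n , δ<k , ≤-trans (*-monoˡ-≤ (a ^ δ (length L)) le) h

  -- From the condition on 4-sets to nice weights: heavy triples, heavy pairs, raising.

  am-gm-tight : ∀ ws t s → length ws ≡ t + s → sum ws ≤ length ws * a + s → product ws ≤ a ^ t * r ^ s
  am-gm-tight ws t s len h = *-cancelʳ-≤ _ _ (a ^ s) {{m^n≢0 a s}} (begin
    product ws * a ^ s          ≤⟨ am-gm ws s h ⟩
    a ^ length ws * r ^ s       ≡⟨ cong (_* r ^ s) (trans (cong (a ^_) len) (^-distribˡ-+-* a t s)) ⟩
    a ^ t * a ^ s * r ^ s       ≡⟨ lemma (a ^ t) (a ^ s) (r ^ s) ⟩
    a ^ t * r ^ s * a ^ s       ∎)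
    where
    open ≤-Reasoning
    lemma : ∀ x y z → x * y * z ≡ x * z * y
    lemma = solve-∀

  b<⇒a≤ : ∀ {x} → b < x → a ≤ x
  b<⇒a≤ b<x = ≤-trans (≤-reflexive a≡1+b) b<x

  module _ {V : Set} (_≟ⱽ_ : DecidableEquality V) {w : V → V → ℕ} (sym-w : Symmetric w)
    (four : ∀ {x y z t} → Unique (x ∷ y ∷ z ∷ t ∷ []) → pairSum w (x ∷ y ∷ z ∷ t ∷ []) ≤ 6 * a + 3) where

    four-product : ∀ {x y z t} → Unique (x ∷ y ∷ z ∷ t ∷ []) → pairProduct w (x ∷ y ∷ z ∷ t ∷ []) ≤ a ^ 3 * r ^ 3
    four-product {x} {y} {z} {t} uniq = am-gm-tight (weights w (x ∷ y ∷ z ∷ t ∷ [])) 3 3 refl (four uniq)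

    four-bounded : ∀ {x y z t} → Unique (x ∷ y ∷ z ∷ t ∷ []) → T-bounded 4 (pairProduct w (x ∷ y ∷ z ∷ t ∷ []))
    four-bounded uniq = 1 , 3 , refl , ≤-trans (four-product uniq) (≤-reflexive (cong (_* r ^ 3) (sym (*-identityˡ (a ^ 3)))))

    -- Averaging: each pair lies in three of the five 4-sets, so the total weight is at most 5 (6 a
    -- + 3) / 3 = 10 a + 5, the weight of the red 5-cycle with white diagonals.
    five-bounded : ∀ {x y z t u} → Unique (x ∷ y ∷ z ∷ t ∷ u ∷ []) → Bounded 5 (pairProduct w (x ∷ y ∷ z ∷ t ∷ u ∷ []))
    five-bounded {x} {y} {z} {t} {u} ((xy ∷ xz ∷ xt ∷ xu ∷ []) ∷ (yz ∷ yt ∷ yu ∷ []) ∷ (zt ∷ zu ∷ []) ∷ (tu ∷ []) ∷ [] ∷ []) =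
      cycle-bounded {pairProduct w (x ∷ y ∷ z ∷ t ∷ u ∷ [])} (≤-trans (am-gm-tight (weights w (x ∷ y ∷ z ∷ t ∷ u ∷ [])) 5 5 refl (*-cancelˡ-≤ 3 (begin
        3 * pairSum w (x ∷ y ∷ z ∷ t ∷ u ∷ [])
          ≡⟨ count (w x y) (w x z) (w x t) (w x u) (w y z) (w y t) (w y u) (w z t) (w z u) (w t u) ⟩
        pairSum w (x ∷ y ∷ z ∷ t ∷ []) + pairSum w (x ∷ y ∷ z ∷ u ∷ []) + pairSum w (x ∷ y ∷ t ∷ u ∷ [])
          + pairSum w (x ∷ z ∷ t ∷ u ∷ []) + pairSum w (y ∷ z ∷ t ∷ u ∷ [])
          ≤⟨ +-mono-≤ (+-mono-≤ (+-mono-≤ (+-mono-≤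
               (four ((xy ∷ xz ∷ xt ∷ []) ∷ (yz ∷ yt ∷ []) ∷ (zt ∷ []) ∷ [] ∷ []))
               (four ((xy ∷ xz ∷ xu ∷ []) ∷ (yz ∷ yu ∷ []) ∷ (zu ∷ []) ∷ [] ∷ [])))
               (four ((xy ∷ xt ∷ xu ∷ []) ∷ (yt ∷ yu ∷ []) ∷ (tu ∷ []) ∷ [] ∷ [])))
               (four ((xz ∷ xt ∷ xu ∷ []) ∷ (zt ∷ zu ∷ []) ∷ (tu ∷ []) ∷ [] ∷ [])))
               (four ((yz ∷ yt ∷ yu ∷ []) ∷ (zt ∷ zu ∷ []) ∷ (tu ∷ []) ∷ [] ∷ [])) ⟩
        (6 * a + 3) + (6 * a + 3) + (6 * a + 3) + (6 * a + 3) + (6 * a + 3)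
          ≡⟨ total a ⟩
        3 * (10 * a + 5) ∎))) (≤-reflexive (powers a r)))
      where
      open ≤-Reasoning
      count : ∀ xy xz xt xu yz yt yu zt zu tu →
        3 * (xy + (xz + (xt + (xu + (yz + (yt + (yu + (zt + (zu + (tu + 0))))))))))
        ≡ (xy + (xz + (xt + (yz + (yt + (zt + 0)))))) + (xy + (xz + (xu + (yz + (yu + (zu + 0))))))
        + (xy + (xt + (xu + (yt + (yu + (tu + 0)))))) + (xz + (xt + (xu + (zt + (zu + (tu + 0))))))
        + (yz + (yt + (yu + (zt + (zu + (tu + 0))))))
      count = solve-∀
      total : ∀ a → (6 * a + 3) + (6 * a + 3) + (6 * a + 3) + (6 * a + 3) + (6 * a + 3) ≡ 3 * (10 * a + 5)
      total = solve-∀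
      powers : ∀ a r → a * (a * (a * (a * (a * 1)))) * (r * (r * (r * (r * (r * 1))))) ≡ a * a * a * a * a * (r * r * r * r * r)
      powers = solve-∀

    -- The threshold is the weight of a red triangle. Of the 6 a + 3 allowed on a 4-set it leaves at
    -- most 3 a for the pairs to a fourth vertex, an average of a.
    Heavy : V → V → V → Set
    Heavy x y z = 3 * a + 3 ≤ pairSum w (x ∷ y ∷ z ∷ [])

    -- If the triple xyz is at least as heavy as pqs, the three 4-sets containing it
    -- bound the total weight.
    six-bounded : ∀ {x y z p q s} → Unique (x ∷ y ∷ z ∷ p ∷ q ∷ s ∷ []) → Heavy x y z →
      pairSum w (p ∷ q ∷ s ∷ []) ≤ pairSum w (x ∷ y ∷ z ∷ []) → T-bounded 6 (pairProduct w (x ∷ y ∷ z ∷ p ∷ q ∷ s ∷ []))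
    six-bounded {x} {y} {z} {p} {q} {s}
      ((xy ∷ xz ∷ xp ∷ xq ∷ xs ∷ []) ∷ (yz ∷ yp ∷ yq ∷ ys ∷ []) ∷ (zp ∷ zq ∷ zs ∷ []) ∷ _) heavy Y≤X =
      2 , 4 , refl , ≤-trans (am-gm-tight (weights w (x ∷ y ∷ z ∷ p ∷ q ∷ s ∷ [])) 9 6 refl
        (+-cancelʳ-≤ (3 * a + 3 + X) _ _ (begin
          pairSum w (x ∷ y ∷ z ∷ p ∷ q ∷ s ∷ []) + (3 * a + 3 + X)
            ≤⟨ +-monoʳ-≤ (pairSum w (x ∷ y ∷ z ∷ p ∷ q ∷ s ∷ [])) (+-monoˡ-≤ X heavy) ⟩
          pairSum w (x ∷ y ∷ z ∷ p ∷ q ∷ s ∷ []) + (X + X)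
            ≡⟨ count (w x y) (w x z) (w x p) (w x q) (w x s) (w y z) (w y p) (w y q) (w y s) (w z p) (w z q) (w z s) (w p q) (w p s) (w q s) ⟩
          pairSum w (p ∷ q ∷ s ∷ []) + (pairSum w (x ∷ y ∷ z ∷ p ∷ []) + pairSum w (x ∷ y ∷ z ∷ q ∷ []) + pairSum w (x ∷ y ∷ z ∷ s ∷ []))
            ≤⟨ +-mono-≤ Y≤X (+-mono-≤ (+-mono-≤
                 (four ((xy ∷ xz ∷ xp ∷ []) ∷ (yz ∷ yp ∷ []) ∷ (zp ∷ []) ∷ [] ∷ []))
                 (four ((xy ∷ xz ∷ xq ∷ []) ∷ (yz ∷ yq ∷ []) ∷ (zq ∷ []) ∷ [] ∷ [])))
                 (four ((xy ∷ xz ∷ xs ∷ []) ∷ (yz ∷ ys ∷ []) ∷ (zs ∷ []) ∷ [] ∷ []))) ⟩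
          X + ((6 * a + 3) + (6 * a + 3) + (6 * a + 3))
            ≡⟨ total a X ⟩
          15 * a + 6 + (3 * a + 3 + X) ∎))) enough
      where
      open ≤-Reasoning
      X = pairSum w (x ∷ y ∷ z ∷ [])
      count : ∀ xy xz xp xq xs yz yp yq ys zp zq zs pq ps qs →
        xy + (xz + (xp + (xq + (xs + (yz + (yp + (yq + (ys + (zp + (zq + (zs + (pq + (ps + (qs + 0))))))))))))))
          + ((xy + (xz + (yz + 0))) + (xy + (xz + (yz + 0))))
        ≡ (pq + (ps + (qs + 0))) + ((xy + (xz + (xp + (yz + (yp + (zp + 0)))))) + (xy + (xz + (xq + (yz + (yq + (zq + 0))))))
          + (xy + (xz + (xs + (yz + (ys + (zs + 0)))))))
      count = solve-∀
      total : ∀ a X → X + ((6 * a + 3) + (6 * a + 3) + (6 * a + 3)) ≡ 15 * a + 6 + (3 * a + 3 + X)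
      total = solve-∀
      lemma : ∀ A a R → a * (a * (a * A)) * R ≡ a * (a * a) * (A * R)
      lemma = solve-∀
      lemma′ : ∀ b A r R → b * (r * r) * (A * R) ≡ b * 1 * A * (r * (r * R))
      lemma′ = solve-∀
      enough : a ^ 9 * r ^ 6 ≤ T 2 4
      enough = begin
        a ^ 9 * r ^ 6                    ≡⟨ lemma (a ^ 6) a (r ^ 6) ⟩
        a * (a * a) * (a ^ 6 * r ^ 6)    ≤⟨ *-monoˡ-≤ (a ^ 6 * r ^ 6) aaa≤brr ⟩
        b * (r * r) * (a ^ 6 * r ^ 6)    ≡⟨ lemma′ b (a ^ 6) r (r ^ 6) ⟩
        T 2 4                            ∎

    -- AM-GM is applied twice: the triple with v is a 4-set and has product at most a ^ 3 r ^ 3, and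
    -- any other vertex receives weight at most 3 a, hence product at most a ^ 3.
    remove-triple : ∀ {x y z v L} → Unique (x ∷ y ∷ z ∷ v ∷ L) → Heavy x y z → Bounded (length (v ∷ L)) (pairProduct w (v ∷ L)) →
      T-bounded (3 + length (v ∷ L)) (pairProduct w (x ∷ y ∷ z ∷ v ∷ L))
    remove-triple {x} {y} {z} {v} {L} uniq heavy bounded = remove₃ {length (v ∷ L)} {pairProduct w (v ∷ L)} bounded (begin
      pairProduct w (x ∷ y ∷ z ∷ v ∷ L)
        ≤⟨ pairProduct-++-∷-≤ w (x ∷ y ∷ z ∷ []) (four-product (quad uniq (here refl))) (All.tabulate light) ⟩
      a ^ 3 * r ^ 3 * (a * (a * a)) ^ length L * pairProduct w (v ∷ L)
        ≡⟨ cong (_* pairProduct w (v ∷ L)) (lemma a r ((a * (a * a)) ^ length L)) ⟩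
      r * r * r * (a * (a * a)) ^ length (v ∷ L) * pairProduct w (v ∷ L) ∎)
      where
      open ≤-Reasoning
      quad : ∀ {x y z u L} → Unique (x ∷ y ∷ z ∷ L) → u ∈ L → Unique (x ∷ y ∷ z ∷ u ∷ [])
      quad ((xy ∷ xz ∷ x≢) ∷ (yz ∷ y≢) ∷ z≢ ∷ _) u∈ =
        (xy ∷ xz ∷ All.lookup x≢ u∈ ∷ []) ∷ (yz ∷ All.lookup y≢ u∈ ∷ []) ∷ (All.lookup z≢ u∈ ∷ []) ∷ [] ∷ []
      light : ∀ {u} → u ∈ L → productTo w (x ∷ y ∷ z ∷ []) u ≤ a * (a * a)
      light {u} u∈ = subst₂ _≤_ (*-identityʳ _) (trans (*-identityʳ (a ^ 3)) (cong (λ m → a * (a * m)) (*-identityʳ a)))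
        (am-gm (map (λ t → w t u) (x ∷ y ∷ z ∷ [])) 0 (+-cancelˡ-≤ (3 * a + 3) _ _ (begin
          3 * a + 3 + (w x u + (w y u + (w z u + 0)))
            ≤⟨ +-monoˡ-≤ (w x u + (w y u + (w z u + 0))) heavy ⟩
          pairSum w (x ∷ y ∷ z ∷ []) + (w x u + (w y u + (w z u + 0)))
            ≡⟨ count (w x y) (w x z) (w x u) (w y z) (w y u) (w z u) ⟩
          pairSum w (x ∷ y ∷ z ∷ u ∷ [])
            ≤⟨ four (quad uniq (there u∈)) ⟩
          6 * a + 3
            ≡⟨ total a ⟩
          3 * a + 3 + (3 * a + 0) ∎)))
        where
        count : ∀ xy xz xu yz yu zu → (xy + (xz + (yz + 0))) + (xu + (yu + (zu + 0))) ≡ xy + (xz + (xu + (yz + (yu + (zu + 0)))))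
        count = solve-∀
        total : ∀ a → 6 * a + 3 ≡ 3 * a + 3 + (3 * a + 0)
        total = solve-∀
      lemma : ∀ a r K → a * (a * (a * 1)) * (r * (r * (r * 1))) * K ≡ r * r * r * (a * (a * a) * K)
      lemma = solve-∀

    -- Since no triple on the edge exceeds 3 a + 2, the edge sends at most 2 a to each vertex, and
    -- the triple with v has product at most a r r however heavy the edge is.
    remove-edge : ∀ {x y v L} → a + 2 ≤ w x y →
      (∀ {u} → u ∈ v ∷ L → pairSum w (x ∷ y ∷ u ∷ []) ≤ 3 * a + 2) → Bounded (length (v ∷ L)) (pairProduct w (v ∷ L)) →
      T-bounded (2 + length (v ∷ L)) (pairProduct w (x ∷ y ∷ v ∷ L))
    remove-edge {x} {y} {v} {L} edge triple bounded = remove₂ {length (v ∷ L)} {pairProduct w (v ∷ L)} bounded (begin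
      pairProduct w (x ∷ y ∷ v ∷ L) * a
        ≤⟨ *-monoˡ-≤ a (pairProduct-++-∷-≤ w (x ∷ y ∷ [])
             (am-gm-tight (weights w (x ∷ y ∷ v ∷ [])) 1 2 refl (triple (here refl))) (All.tabulate light)) ⟩
      a ^ 1 * r ^ 2 * (a * a) ^ length L * pairProduct w (v ∷ L) * a
        ≡⟨ lemma a r ((a * a) ^ length L) (pairProduct w (v ∷ L)) ⟩
      r * r * (a * a) ^ length (v ∷ L) * pairProduct w (v ∷ L) ∎)
      where
      open ≤-Reasoning
      light : ∀ {u} → u ∈ L → productTo w (x ∷ y ∷ []) u ≤ a * a
      light {u} u∈ = subst₂ _≤_ (*-identityʳ _) (trans (*-identityʳ (a ^ 2)) (cong (a *_) (*-identityʳ a)))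
        (am-gm (map (λ t → w t u) (x ∷ y ∷ [])) 0 (+-cancelˡ-≤ (a + 2) _ _ (begin
          a + 2 + (w x u + (w y u + 0))      ≤⟨ +-monoˡ-≤ (w x u + (w y u + 0)) edge ⟩
          w x y + (w x u + (w y u + 0))      ≤⟨ triple (there u∈) ⟩
          3 * a + 2                          ≡⟨ total a ⟩
          a + 2 + (2 * a + 0)                ∎)))
        where
        total : ∀ a → 3 * a + 2 ≡ a + 2 + (2 * a + 0)
        total = solve-∀
      lemma : ∀ a r K p → a * 1 * (r * (r * 1)) * K * p * a ≡ r * r * (a * a * K) * p
      lemma = solve-∀

    module Raise (L : List V)
      (¬heavy : ∀ {x y z} → x ∈ L → y ∈ L → z ∈ L → x ≢ y → x ≢ z → y ≢ z → ¬ Heavy x y z)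
      (≤r : ∀ {x y} → x ∈ L → y ∈ L → x ≢ y → w x y ≤ r) where

      Proper : V → V → Set
      Proper x y = x ∈ L × y ∈ L × x ≢ y

      proper? : ∀ x y → Dec (Proper x y)
      proper? x y = any? (x ≟ⱽ_) L ×-dec any? (y ≟ⱽ_) L ×-dec ¬? (x ≟ⱽ y)

      -- Pairs outside L are made blue so that the result is nice on all of V.
      raise : V → V → ℕ
      raise x y = if does (proper? x y) then b ⊔ w x y else b

      raise-proper : ∀ {x y} → Proper x y → raise x y ≡ b ⊔ w x y
      raise-proper {x} {y} p = cong (λ d → if d then b ⊔ w x y else b) (dec-true (proper? x y) p)

      raise-improper : ∀ {x y} → ¬ Proper x y → raise x y ≡ b
      raise-improper {x} {y} p = cong (λ d → if d then b ⊔ w x y else b) (dec-false (proper? x y) p)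

      -- Raising stops at b and so creates no red pair; this is why restrictions on red pairs carry
      -- over from w.
      red⇒proper : ∀ {x y} → raise x y ≡ r → Proper x y × w x y ≡ r
      red⇒proper {x} {y} red = by-cases (proper? x y)
        where
        by-cases : Dec (Proper x y) → Proper x y × w x y ≡ r
        by-cases (no ¬p) = contradiction (trans (sym (raise-improper ¬p)) red) b≢r
        by-cases (yes p) with ⊔-sel b (w x y)
        ... | inj₁ ≡b = contradiction (trans (sym ≡b) (trans (sym (raise-proper p)) red)) b≢r
        ... | inj₂ ≡w = p , trans (sym ≡w) (trans (sym (raise-proper p)) red)

      raise-≤b : ∀ {x y} → w x y ≤ b → raise x y ≡ b
      raise-≤b {x} {y} ≤b = by-cases (proper? x y)
        where
        by-cases : Dec (Proper x y) → raise x y ≡ b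
        by-cases (yes p) = trans (raise-proper p) (m≥n⇒m⊔n≡m ≤b)
        by-cases (no ¬p) = raise-improper ¬p

      raise-range : ∀ x y → raise x y ≡ b ⊎ raise x y ≡ a ⊎ raise x y ≡ r
      raise-range x y = by-cases (proper? x y) (w x y ≤? b) (w x y ≤? a)
        where
        by-cases : Dec (Proper x y) → Dec (w x y ≤ b) → Dec (w x y ≤ a) → raise x y ≡ b ⊎ raise x y ≡ a ⊎ raise x y ≡ r
        by-cases (no ¬p) _ _ = inj₁ (raise-improper ¬p)
        by-cases (yes p) (yes ≤b) _ = inj₁ (raise-≤b ≤b)
        by-cases (yes p) (no ≰b) (yes ≤a) = inj₂ (inj₁ (trans (raise-proper p)
          (trans (m≤n⇒m⊔n≡n (<⇒≤ (≰⇒> ≰b))) (≤-antisym ≤a (b<⇒a≤ (≰⇒> ≰b))))))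
        by-cases (yes p@(x∈ , y∈ , x≢y)) (no ≰b) (no ≰a) = inj₂ (inj₂ (trans (raise-proper p)
          (trans (m≤n⇒m⊔n≡n (<⇒≤ (≰⇒> ≰b))) (≤-antisym (≤r x∈ y∈ x≢y) (≤-trans (≤-reflexive r≡1+a) (≰⇒> ≰a))))))

      raise-sym : Symmetric raise
      raise-sym x y = by-cases (proper? x y)
        where
        swap : ∀ {x y} → Proper x y → Proper y x
        swap (x∈ , y∈ , x≢y) = y∈ , x∈ , ≢-sym x≢y
        by-cases : Dec (Proper x y) → raise x y ≡ raise y x
        by-cases (yes p) = trans (raise-proper p) (trans (cong (b ⊔_) (sym-w x y)) (sym (raise-proper (swap p))))
        by-cases (no ¬p) = trans (raise-improper ¬p) (sym (raise-improper (λ p → ¬p (swap p))))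

      raise-triangle : ∀ {x y z} → raise x y ≡ r → raise y z ≡ r → raise z x ≡ r → ⊥
      raise-triangle {x} {y} {z} xy yz zx with red⇒proper xy | red⇒proper yz | red⇒proper zx
      ... | (x∈ , y∈ , x≢y) , xy≡ | (_ , z∈ , y≢z) , yz≡ | (_ , _ , z≢x) , zx≡ =
        ¬heavy x∈ y∈ z∈ x≢y (≢-sym z≢x) y≢z (≤-reflexive (begin
          3 * a + 3                       ≡⟨ lemma a ⟩
          suc a + (suc a + (suc a + 0))   ≡⟨ cong (λ r → r + (r + (r + 0))) r≡1+a ⟨
          r + (r + (r + 0))               ≡⟨ cong₂ _+_ xy≡ (cong₂ (λ m n → m + (n + 0)) (trans (sym-w x z) zx≡) yz≡) ⟨
          w x y + (w x z + (w y z + 0))   ∎))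
        where
        open ≡-Reasoning
        lemma : ∀ a → 3 * a + 3 ≡ suc a + (suc a + (suc a + 0))
        lemma = solve-∀

      -- Four red pairs and two diagonals of multiplicity at least a would weigh at least 4 r + 2 a
      -- = 6 a + 4, one more than a 4-set may.
      raise-four-cycle : ∀ {x y z t} → raise x y ≡ r → raise y z ≡ r → raise z t ≡ r → raise t x ≡ r →
        raise x z ≡ b ⊎ raise y t ≡ b
      raise-four-cycle {x} {y} {z} {t} xy yz zt tx with red⇒proper xy | red⇒proper yz | red⇒proper zt | red⇒proper tx
      ... | (_ , _ , x≢y) , xy≡ | (_ , _ , y≢z) , yz≡ | (_ , _ , z≢t) , zt≡ | (_ , _ , t≢x) , tx≡ =
        by-cases (x ≟ⱽ z) (y ≟ⱽ t) (w x z ≤? b) (w y t ≤? b)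
        where
        open ≤-Reasoning
        count : ∀ a → suc (6 * a + 3) ≡ suc a + (a + (suc a + (suc a + (a + (suc a + 0)))))
        count = solve-∀
        by-cases : Dec (x ≡ z) → Dec (y ≡ t) → Dec (w x z ≤ b) → Dec (w y t ≤ b) → raise x z ≡ b ⊎ raise y t ≡ b
        by-cases (yes x≡z) _ _ _ = inj₁ (raise-improper (λ (_ , _ , x≢z) → x≢z x≡z))
        by-cases (no _) (yes y≡t) _ _ = inj₂ (raise-improper (λ (_ , _ , y≢t) → y≢t y≡t))
        by-cases (no _) (no _) (yes ≤b) _ = inj₁ (raise-≤b ≤b)
        by-cases (no _) (no _) (no _) (yes ≤b) = inj₂ (raise-≤b ≤b)
        by-cases (no x≢z) (no y≢t) (no xz≰b) (no yt≰b) = contradiction (begin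
          suc (6 * a + 3)
            ≡⟨ count a ⟩
          suc a + (a + (suc a + (suc a + (a + (suc a + 0)))))
            ≡⟨ cong (λ r → r + (a + (r + (r + (a + (r + 0)))))) r≡1+a ⟨
          r + (a + (r + (r + (a + (r + 0)))))
            ≤⟨ +-mono-≤ (≤-reflexive (sym xy≡)) (+-mono-≤ (b<⇒a≤ (≰⇒> xz≰b)) (+-mono-≤ (≤-reflexive (sym (trans (sym-w x t) tx≡)))
                 (+-mono-≤ (≤-reflexive (sym yz≡)) (+-mono-≤ (b<⇒a≤ (≰⇒> yt≰b)) (+-mono-≤ (≤-reflexive (sym zt≡)) (≤-refl {0})))))) ⟩
          pairSum w (x ∷ y ∷ z ∷ t ∷ [])
            ≤⟨ four ((x≢y ∷ x≢z ∷ ≢-sym t≢x ∷ []) ∷ (y≢z ∷ y≢t ∷ []) ∷ (z≢t ∷ []) ∷ [] ∷ []) ⟩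
          6 * a + 3 ∎) (<-irrefl refl)

      raise-nice : Nice raise
      raise-nice = record
        { symmetric  = raise-sym
        ; diagonal   = λ x → raise-improper (λ (_ , _ , x≢x) → x≢x refl)
        ; range      = raise-range
        ; triangle   = raise-triangle
        ; four-cycle = raise-four-cycle
        }

      raise-bounded : Unique L → 0 < length L → Bounded (length L) (pairProduct w L)
      raise-bounded uniq 0<n with nice-bounded _≟ⱽ_ raise-nice L 0<n
      ... | k , l , k+l≡n , δ<k , h = k , l , k+l≡n , δ<k , ≤-trans (*-monoˡ-≤ (a ^ δ (length L)) (pairProduct-mono
              (AllPairs-∈ (λ {x} {y} x∈ y∈ x≢y → ≤-trans (m≤n⊔m b (w x y)) (≤-reflexive (sym (raise-proper (x∈ , y∈ , x≢y))))) uniq))) h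

    heavy-triple? : ∀ L → Dec (∃ λ x → x ∈ L × ∃ λ y → y ∈ L × ∃ λ z → z ∈ L × x ≢ y × x ≢ z × y ≢ z × Heavy x y z)
    heavy-triple? L = ∃∈? (λ x → ∃∈? (λ y → ∃∈? (λ z →
      ¬? (x ≟ⱽ y) ×-dec ¬? (x ≟ⱽ z) ×-dec ¬? (y ≟ⱽ z) ×-dec (_ ≤? _)) L) L) L

    heavy-edge? : ∀ L → Dec (∃ λ x → x ∈ L × ∃ λ y → y ∈ L × x ≢ y × a + 2 ≤ w x y)
    heavy-edge? L = ∃∈? (λ x → ∃∈? (λ y → ¬? (x ≟ⱽ y) ×-dec (_ ≤? _)) L) L

    bounded-↭ : ∀ {L L′} → L ↭ L′ → Bounded (length L′) (pairProduct w L′) → Bounded (length L) (pairProduct w L)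
    bounded-↭ p = subst₂ Bounded (sym (↭-length p)) (sym (pairProduct-↭ sym-w p))

    -- Fewer than four vertices are not controlled by the condition on 4-sets, so the induction must
    -- not fall below length 4. A heavy triple among six vertices leaves only three, which is why
    -- that case is settled directly by `six-bounded`.
    general-bounded : ∀ L → Acc _<_ (length L) → Unique L → 4 ≤ length L → Bounded (length L) (pairProduct w L)
    general-bounded (x ∷ []) _ _ (s≤s ())
    general-bounded (x ∷ y ∷ []) _ _ (s≤s (s≤s ()))
    general-bounded (x ∷ y ∷ z ∷ []) _ _ (s≤s (s≤s (s≤s ())))
    general-bounded (x ∷ y ∷ z ∷ t ∷ []) _ uniq _ = T-bounded⇒Bounded {4} (s≤s z≤n) (four-bounded uniq)
    general-bounded (x ∷ y ∷ z ∷ t ∷ u ∷ []) _ uniq _ = five-bounded uniq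
    general-bounded L@(_ ∷ _ ∷ _ ∷ _ ∷ _ ∷ _ ∷ _) (acc rec) uniq _ = by-cases (heavy-triple? L) (heavy-edge? L)
      where
      6≤ : 6 ≤ length L
      6≤ = s≤s (s≤s (s≤s (s≤s (s≤s (s≤s z≤n)))))

      after-triple : ∀ {x y z} L′ → L ↭ x ∷ y ∷ z ∷ L′ → Heavy x y z → Bounded (length L) (pairProduct w L)
      after-triple [] L↭ _ with subst (6 ≤_) (↭-length L↭) 6≤
      ... | s≤s (s≤s (s≤s ()))
      after-triple (_ ∷ []) L↭ _ with subst (6 ≤_) (↭-length L↭) 6≤
      ... | s≤s (s≤s (s≤s (s≤s ())))
      after-triple (_ ∷ _ ∷ []) L↭ _ with subst (6 ≤_) (↭-length L↭) 6≤
      ... | s≤s (s≤s (s≤s (s≤s (s≤s ()))))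
      after-triple {x} {y} {z} (p ∷ q ∷ s ∷ []) L↭ heavy = bounded-↭ L↭ (T-bounded⇒Bounded {6} (s≤s z≤n)
        (heaviest (≤-total (pairSum w (p ∷ q ∷ s ∷ [])) (pairSum w (x ∷ y ∷ z ∷ [])))))
        where
        X = x ∷ y ∷ z ∷ []
        Y = p ∷ q ∷ s ∷ []
        heaviest : pairSum w Y ≤ pairSum w X ⊎ pairSum w X ≤ pairSum w Y → T-bounded 6 (pairProduct w (X ++ Y))
        heaviest (inj₁ Y≤X) = six-bounded (Unique-resp-↭ L↭ uniq) heavy Y≤X
        heaviest (inj₂ X≤Y) = subst (T-bounded 6) (pairProduct-↭ sym-w (++-comm Y X))
          -- The complementary triple is at least as heavy, hence heavy itself, and the two exchange
          -- roles.
          (six-bounded (Unique-resp-↭ (↭-trans L↭ (++-comm X Y)) uniq) (≤-trans heavy X≤Y) X≤Y)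
      after-triple {x} {y} {z} L′@(_ ∷ _ ∷ _ ∷ _ ∷ _) L↭ heavy = bounded-↭ L↭ (T-bounded⇒Bounded (s≤s z≤n) (remove-triple uniq′ heavy
        (general-bounded L′ (rec (≤-trans (s≤s (m≤n+m (length L′) 2)) (≤-reflexive (sym (↭-length L↭)))))
          (AllPairs.tail (AllPairs.tail (AllPairs.tail uniq′))) (s≤s (s≤s (s≤s (s≤s z≤n)))))))
        where
        uniq′ : Unique (x ∷ y ∷ z ∷ L′)
        uniq′ = Unique-resp-↭ L↭ uniq

      by-cases : Dec _ → Dec _ → Bounded (length L) (pairProduct w L)
      by-cases (yes (x , x∈ , y , y∈ , z , z∈ , x≢y , x≢z , y≢z , heavy)) _ =
        let L′ , L↭ = extract ((x≢y ∷ x≢z ∷ []) ∷ (y≢z ∷ []) ∷ [] ∷ []) (x∈ ∷ y∈ ∷ z∈ ∷ []) in after-triple L′ L↭ heavy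
      by-cases (no ∄heavy) (yes (x , x∈ , y , y∈ , x≢y , edge)) =
        let L′ , L↭ = extract ((x≢y ∷ []) ∷ [] ∷ []) (x∈ ∷ y∈ ∷ []) in after-edge L′ L↭
        where
        after-edge : ∀ L′ → L ↭ x ∷ y ∷ L′ → Bounded (length L) (pairProduct w L)
        after-edge [] L↭ with subst (6 ≤_) (↭-length L↭) 6≤
        ... | s≤s (s≤s ())
        after-edge L′@(v ∷ L″) L↭ = bounded-↭ L↭ (T-bounded⇒Bounded (s≤s z≤n) (remove-edge edge triple
          (general-bounded L′ (rec (≤-trans (s≤s (m≤n+m (length L′) 1)) (≤-reflexive (sym (↭-length L↭)))))
            (AllPairs.tail (AllPairs.tail uniq′)) (≤-pred (≤-pred (subst (6 ≤_) (↭-length L↭) 6≤))))))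
          where
          uniq′ : Unique (x ∷ y ∷ v ∷ L″)
          uniq′ = Unique-resp-↭ L↭ uniq
          triple : ∀ {u} → u ∈ v ∷ L″ → pairSum w (x ∷ y ∷ u ∷ []) ≤ 3 * a + 2
          triple {u} u∈ with uniq′
          ... | (_ ∷ x≢) ∷ y≢ ∷ _ = ≤-pred (subst (pairSum w (x ∷ y ∷ u ∷ []) <_) (+-suc (3 * a) 2) (≰⇒> (λ heavy → ∄heavy
            (x , x∈ , y , y∈ , u , ∈-resp-↭ (↭-sym L↭) (there (there u∈)) , x≢y , All.lookup x≢ u∈ , All.lookup y≢ u∈ , heavy))))
      by-cases (no ∄heavy) (no ∄edge) = Raise.raise-bounded L
        (λ x∈ y∈ z∈ x≢y x≢z y≢z heavy → ∄heavy (_ , x∈ , _ , y∈ , _ , z∈ , x≢y , x≢z , y≢z , heavy))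
        (λ {x} {y} x∈ y∈ x≢y → ≤-pred (subst (w x y <_) a+2≡1+r (≰⇒> (λ edge → ∄edge (x , x∈ , y , y∈ , x≢y , edge)))))
        uniq (s≤s z≤n)
        where
        a+2≡1+r : a + 2 ≡ suc r
        a+2≡1+r = trans (+-comm a 2) (cong suc (sym r≡1+a))

-- Translation of `pairs`, `P` and `eIn` into pair products and pair sums over lists.

pairsOf : List V → List (V × V)
pairsOf []       = []
pairsOf (x ∷ xs) = map (x ,_) xs ++ pairsOf xs

map-pairsOf : ∀ (f : V × V → ℕ) {w : V → V → ℕ} → (∀ x y → f (x , y) ≡ w x y) → ∀ xs → map f (pairsOf xs) ≡ weights w xs
map-pairsOf f eq []       = refl
map-pairsOf f {w} eq (x ∷ xs) = trans (map-++ f (map (x ,_) xs) (pairsOf xs))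
  (cong₂ _++_ (trans (sym (map-∘ xs)) (map-cong (eq x) xs)) (map-pairsOf f eq xs))

module _ {n : ℕ} where

  Increasing : List (Fin n) → Set
  Increasing = AllPairs (λ i j → toℕ i < toℕ j)

  above : Fin n → List (Fin n) → List (Fin n × Fin n)
  above i = concatMap (λ j → if toℕ i <ᵇ toℕ j then (i , j) ∷ [] else [])

  above-< : ∀ {i xs} → All (λ j → toℕ i < toℕ j) xs → above i xs ≡ map (i ,_) xs
  above-< []                = refl
  above-< {i} {j ∷ _} (i<j ∷ p) rewrite dec-true (toℕ i <? toℕ j) i<j = cong (_ ∷_) (above-< p)

  above-≮ : ∀ {i x xs} → ¬ (toℕ i < toℕ x) → above i (x ∷ xs) ≡ above i xs
  above-≮ {i} {x} i≮x rewrite dec-false (toℕ i <? toℕ x) i≮x = refl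

  -- Each row scans the whole list again; on an increasing list the comparison rejects just the
  -- row's own vertex and the earlier ones, so the head x drops out of all later rows.
  concatMap-above : ∀ {xs} → Increasing xs → concatMap (λ i → above i xs) xs ≡ pairsOf xs
  concatMap-above [] = refl
  concatMap-above {x ∷ xs} (x< ∷ inc) = cong₂ _++_
    (trans (above-≮ {x} {x} {xs} (<-irrefl refl)) (above-< x<))
    (trans (drop-x x<) (concatMap-above inc))
    where
    drop-x : ∀ {ys} → All (λ j → toℕ x < toℕ j) ys → concatMap (λ i → above i (x ∷ xs)) ys ≡ concatMap (λ i → above i xs) ys
    drop-x []        = refl
    drop-x {y ∷ _} (x<y ∷ p) = cong₂ _++_ (above-≮ {y} {x} {xs} (<-asym x<y)) (drop-x p)

allFin-increasing : ∀ n → Increasing (allFin n)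
allFin-increasing n = AllPairsₚ.tabulate⁺-< (λ i<j → i<j)

pairs≡pairsOf : ∀ n → pairs n ≡ pairsOf (allFin n)
pairs≡pairsOf n = concatMap-above (allFin-increasing n)

P≡pairProduct : ∀ {n} (w : Multigraph n) → P w ≡ pairProduct w (allFin n)
P≡pairProduct {n} w = cong product (trans (cong (map _) (pairs≡pairsOf n)) (map-pairsOf _ (λ _ _ → refl) (allFin n)))

pairSum-filter : ∀ (χ : V → Bool) (w : V → V → ℕ) xs →
  pairSum (λ x y → if χ x ∧ χ y then w x y else 0) xs ≡ pairSum w (filterᵇ χ xs)
pairSum-filter χ w [] = refl
pairSum-filter χ w (x ∷ xs) with χ x
... | true  = trans (sum-++ (map _ xs) _) (trans (cong₂ _+_ (row xs) (pairSum-filter χ w xs)) (sym (sum-++ (map (w x) (filterᵇ χ xs)) _)))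
  where
  row : ∀ ys → sum (map (λ y → if χ y then w x y else 0) ys) ≡ sum (map (w x) (filterᵇ χ ys))
  row [] = refl
  row (y ∷ ys) with χ y
  ... | true  = cong (w x y +_) (row ys)
  ... | false = row ys
... | false = trans (sum-++ (map _ xs) _) (cong₂ _+_ (row xs) (pairSum-filter χ w xs))
  where
  row : ∀ ys → sum (map (λ _ → 0) ys) ≡ 0
  row []       = refl
  row (y ∷ ys) = row ys

members : ∀ {n} → Subset n → List (Fin n)
members {n} X = filterᵇ (lookup X) (allFin n)

eIn≡pairSum : ∀ {n} (w : Multigraph n) X → eIn w X ≡ pairSum w (members X)
eIn≡pairSum {n} w X = trans
  (cong sum (trans (cong (map _) (pairs≡pairsOf n)) (map-pairsOf _ (λ _ _ → refl) (allFin n))))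
  (pairSum-filter (lookup X) w (allFin n))

length-filterᵇ-tabulate : ∀ {n} (X : Subset n) (f : Fin n → V) (χ : V → Bool) → (∀ i → χ (f i) ≡ lookup X i) →
  length (filterᵇ χ (tabulate f)) ≡ ∣ X ∣
length-filterᵇ-tabulate [] f χ eq = refl
length-filterᵇ-tabulate (true ∷ X) f χ eq rewrite eq zero =
  cong suc (length-filterᵇ-tabulate X (f ∘ suc) χ (eq ∘ suc))
length-filterᵇ-tabulate (false ∷ X) f χ eq rewrite eq zero =
  length-filterᵇ-tabulate X (f ∘ suc) χ (eq ∘ suc)

length-members : ∀ {n} (X : Subset n) → length (members X) ≡ ∣ X ∣
length-members X = length-filterᵇ-tabulate X (λ i → i) (lookup X) (λ _ → refl)

members-increasing : ∀ {n} (X : Subset n) → Increasing (members X)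
members-increasing {n} X = AllPairsₚ.filter⁺ (T? ∘ lookup X) (allFin-increasing n)

fromList : ∀ {n} → List (Fin n) → Subset n
fromList xs = Vec.tabulate (λ i → ⌊ any? (i ≟ᶠ_) xs ⌋)

members-fromList : ∀ {n} {xs : List (Fin n)} → Unique xs → members (fromList xs) ↭ xs
members-fromList {n} {xs} uniq = ∼bag⇒↭ (unique∧set⇒bag (filter⁺ (T? ∘ lookup X) (allFin⁺ n)) uniq (mk⇔ from to))
  where
  X = fromList xs
  from : ∀ {i} → i ∈ members X → i ∈ xs
  from {i} i∈ = toWitness {a? = any? (i ≟ᶠ_) xs} (subst Bool.T (lookup∘tabulate _ i) (proj₂ (∈-filter⁻ (T? ∘ lookup X) {xs = allFin n} i∈)))
  to : ∀ {i} → i ∈ xs → i ∈ members X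
  to {i} i∈ = ∈-filter⁺ (T? ∘ lookup X) (∈-allFin i) (subst Bool.T (sym (lookup∘tabulate _ i)) (fromWitness {a? = any? (i ≟ᶠ_) xs} i∈))

-- Only entries with i < j are meaningful in a `Multigraph`, whereas reordering lists of vertices
-- requires a symmetric weight; the upper triangle is reflected.
symmetrise : ∀ {n} → Multigraph n → Multigraph n
symmetrise w i j = if toℕ i <ᵇ toℕ j then w i j else w j i

module _ {n : ℕ} (w : Multigraph n) where

  symmetrise-< : ∀ {i j} → toℕ i < toℕ j → w i j ≡ symmetrise w i j
  symmetrise-< {i} {j} i<j = sym (cong (λ d → if d then w i j else w j i) (dec-true (toℕ i <? toℕ j) i<j))

  symmetrise-≮ : ∀ {i j} → ¬ (toℕ i < toℕ j) → w j i ≡ symmetrise w i j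
  symmetrise-≮ {i} {j} i≮j = sym (cong (λ d → if d then w i j else w j i) (dec-false (toℕ i <? toℕ j) i≮j))

  symmetrise-sym : Symmetric (symmetrise w)
  symmetrise-sym i j with <-cmp (toℕ i) (toℕ j)
  ... | tri< i<j _ _  = trans (sym (symmetrise-< i<j)) (symmetrise-≮ (<-asym i<j))
  ... | tri> _ _ j<i  = trans (sym (symmetrise-≮ (<-asym j<i))) (symmetrise-< j<i)
  ... | tri≈ _ i≡j _ with toℕ-injective i≡j
  ... | refl = refl

  weights-symmetrise : ∀ {xs} → Increasing xs → weights w xs ≡ weights (symmetrise w) xs
  weights-symmetrise inc = weights-cong (AllPairs.map symmetrise-< inc)

  four-sets : ∀ {q} → InF n 4 q w → ∀ {x y z t} → Unique (x ∷ y ∷ z ∷ t ∷ []) →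
    pairSum (symmetrise w) (x ∷ y ∷ z ∷ t ∷ []) ≤ q
  four-sets w∈F {x} {y} {z} {t} uniq = subst (_≤ _) eq
    (w∈F X (trans (sym (length-members X)) (↭-length (members-fromList uniq))))
    where
    X = fromList (x ∷ y ∷ z ∷ t ∷ [])
    eq : eIn w X ≡ pairSum (symmetrise w) (x ∷ y ∷ z ∷ t ∷ [])
    eq = trans (eIn≡pairSum w X) (trans (cong sum (weights-symmetrise (members-increasing X)))
      (pairSum-↭ symmetrise-sym (members-fromList uniq)))

-- The graphs of `InT` and the equality of the two maxima.

weights-map : ∀ (f : V → W) (c : W → W → ℕ) xs → weights (λ x y → c (f x) (f y)) xs ≡ weights c (map f xs)
weights-map f c []       = refl
weights-map f c (x ∷ xs) = cong₂ _++_ (map-∘ xs) (weights-map f c xs)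

data Split : List (Fin 2) → ℕ → ℕ → Set where
  []   : Split [] 0 0
  0∷_  : ∀ {cs k l} → Split cs k l → Split (zero ∷ cs) (suc k) l
  1∷_  : ∀ {cs k l} → Split cs k l → Split (suc zero ∷ cs) k (suc l)

split : ∀ cs → ∃ λ k → ∃ λ l → k + l ≡ length cs × Split cs k l
split [] = 0 , 0 , refl , []
split (zero ∷ cs) = let k , l , eq , s = split cs in suc k , l , cong suc eq , 0∷ s
split (suc zero ∷ cs) = let k , l , eq , s = split cs in k , suc l , trans (+-suc k l) (cong suc eq) , 1∷ s

colouring : ∀ k l → ∃ λ (f : Fin (k + l) → Fin 2) → Split (tabulate f) k l
colouring zero    zero    = (λ ()) , []
colouring zero    (suc l) = (λ _ → suc zero) , (1∷ ones l)
  where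
  ones : ∀ l → Split (tabulate {n = l} (λ _ → suc zero)) 0 l
  ones zero    = []
  ones (suc l) = 1∷ ones l
colouring (suc k) l with colouring k l
... | f , s = (λ { zero → zero ; (suc i) → f i }) , (0∷ s)

module Colours (b : ℕ) (1≤b : 1 ≤ b) where
  open Multiplicities b (suc b) (suc (suc b)) 1≤b refl refl

  a r : ℕ
  a = suc b
  r = suc a

  -- Has the shape of the right-hand side in `InT 2 1 a`, so that a colouring yields a member of
  -- `InT` by `refl`.
  c : Fin 2 → Fin 2 → ℕ
  c u v = if toℕ u ≡ᵇ toℕ v then (if toℕ u ≡ᵇ 0 then a ∸ 1 else a) else suc a

  degree-0 : ∀ {cs k l} → Split cs k l → degree c zero cs ≡ b ^ k * r ^ l
  degree-0 [] = refl
  degree-0 {k = suc k} {l} (0∷ s) = trans (cong (b *_) (degree-0 s)) (sym (*-assoc b (b ^ k) (r ^ l)))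
  degree-0 {k = k} {suc l} (1∷ s) = trans (cong (r *_) (degree-0 s)) (lemma r (b ^ k) (r ^ l))
    where
    lemma : ∀ r x y → r * (x * y) ≡ x * (r * y)
    lemma = solve-∀

  degree-1 : ∀ {cs k l} → Split cs k l → degree c (suc zero) cs ≡ a ^ l * r ^ k
  degree-1 [] = refl
  degree-1 {k = k} {suc l} (1∷ s) = trans (cong (a *_) (degree-1 s)) (sym (*-assoc a (a ^ l) (r ^ k)))
  degree-1 {k = suc k} {l} (0∷ s) = trans (cong (r *_) (degree-1 s)) (lemma r (a ^ l) (r ^ k))
    where
    lemma : ∀ r x y → r * (x * y) ≡ x * (r * y)
    lemma = solve-∀

  pairProduct-split : ∀ {cs k l} → Split cs k l → pairProduct c cs ≡ T k l
  pairProduct-split [] = refl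
  pairProduct-split {zero ∷ cs} {suc k} {l} (0∷ s) = begin
    pairProduct c (zero ∷ cs)              ≡⟨ pairProduct-∷ c zero cs ⟩
    degree c zero cs * pairProduct c cs    ≡⟨ cong₂ _*_ (degree-0 s) (pairProduct-split s) ⟩
    b ^ k * r ^ l * T k l                  ≡⟨ *-comm (b ^ k * r ^ l) (T k l) ⟩
    T k l * (b ^ k * r ^ l)                ≡⟨ T-sucˡ k l ⟨
    T (suc k) l                            ∎
    where open ≡-Reasoning
  pairProduct-split {suc zero ∷ cs} {k} {suc l} (1∷ s) = begin
    pairProduct c (suc zero ∷ cs)              ≡⟨ pairProduct-∷ c (suc zero) cs ⟩
    degree c (suc zero) cs * pairProduct c cs  ≡⟨ cong₂ _*_ (degree-1 s) (pairProduct-split s) ⟩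
    a ^ l * r ^ k * T k l                      ≡⟨ *-comm (a ^ l * r ^ k) (T k l) ⟩
    T k l * (a ^ l * r ^ k)                    ≡⟨ T-sucʳ k l ⟨
    T k (suc l)                                ∎
    where open ≡-Reasoning

  -- With b subtracted from every pair the 4-set bound no longer depends on a, as 6 a + 3 = 6 b + 9,
  -- and checking the 16 colourings of four vertices decides it.
  excess : Fin 2 → Fin 2 → ℕ
  excess zero    zero    = 0
  excess (suc _) (suc _) = 1
  excess _       _       = 2

  c≡excess+b : ∀ u v → c u v ≡ excess u v + b
  c≡excess+b zero       zero       = refl
  c≡excess+b zero       (suc zero) = refl
  c≡excess+b (suc zero) zero       = refl
  c≡excess+b (suc zero) (suc zero) = refl

  excess-≤9 : ∀ p q s t → pairSum excess (p ∷ q ∷ s ∷ t ∷ []) ≤ 9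
  excess-≤9 = from-yes (all? λ p → all? λ q → all? λ s → all? λ t → pairSum excess (p ∷ q ∷ s ∷ t ∷ []) ≤? 9)

  four-colours : ∀ p q s t → pairSum c (p ∷ q ∷ s ∷ t ∷ []) ≤ 6 * a + 3
  four-colours p q s t = begin
    pairSum c (p ∷ q ∷ s ∷ t ∷ [])
      ≡⟨ cong sum (weights-cong {w = c} {w′ = λ u v → excess u v + b} (pointwise (p ∷ q ∷ s ∷ t ∷ []))) ⟩
    pairSum (λ u v → excess u v + b) (p ∷ q ∷ s ∷ t ∷ [])
      ≡⟨ lemma b (excess p q) (excess p s) (excess p t) (excess q s) (excess q t) (excess s t) ⟩
    pairSum excess (p ∷ q ∷ s ∷ t ∷ []) + 6 * b
      ≤⟨ +-monoˡ-≤ (6 * b) (excess-≤9 p q s t) ⟩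
    9 + 6 * b
      ≡⟨ lemma′ b ⟩
    6 * a + 3 ∎
    where
    open ≤-Reasoning
    pointwise : ∀ cs → AllPairs (λ u v → c u v ≡ excess u v + b) cs
    pointwise []       = []
    pointwise (u ∷ cs) = All.tabulate (λ {v} _ → c≡excess+b u v) ∷ pointwise cs
    lemma : ∀ b pq ps pt qs qt st → (pq + b) + ((ps + b) + ((pt + b) + ((qs + b) + ((qt + b) + ((st + b) + 0)))))
          ≡ pq + (ps + (pt + (qs + (qt + (st + 0))))) + 6 * b
    lemma = solve-∀
    lemma′ : ∀ b → 9 + 6 * b ≡ 6 * suc b + 3
    lemma′ = solve-∀

  InF⇒T-bounded : ∀ {n} → 30 ≤ n → (w : Multigraph n) → InF n 4 (6 * a + 3) w → T-bounded n (P w)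
  InF⇒T-bounded {n} 30≤n w w∈F = subst₂ T-bounded len (sym P≡) (Bounded⇒T-bounded n≢5
    (general-bounded _≟ᶠ_ (symmetrise-sym w) (four-sets w w∈F) (allFin n) (<-wellFounded _) (allFin⁺ n)
      (subst (4 ≤_) (sym len) (≤-trans (m≤m+n 4 26) 30≤n))))
    where
    len : length (allFin n) ≡ n
    len = length-tabulate (λ i → i)
    n≢5 : length (allFin n) ≢ 5
    n≢5 eq = <-irrefl (trans (sym eq) len) (≤-trans (m≤m+n 6 24) 30≤n)
    P≡ : P w ≡ pairProduct (symmetrise w) (allFin n)
    P≡ = trans (P≡pairProduct w) (cong product (weights-symmetrise w (allFin-increasing n)))

  P-coloured : ∀ {n} (w : Multigraph n) (f : Fin n → Fin 2) → (∀ i j → toℕ i < toℕ j → w i j ≡ c (f i) (f j)) →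
    P w ≡ pairProduct c (tabulate f)
  P-coloured {n} w f eq = trans (P≡pairProduct w) (cong product
    (trans (weights-cong (AllPairs.map (λ {i} {j} → eq i j) (allFin-increasing n)))
    (trans (weights-map f c (allFin n)) (cong (weights c) (map-tabulate (λ i → i) f)))))

  InT⇒T-bounded : ∀ {n} (w : Multigraph n) → InT 2 1 a n w → T-bounded n (P w)
  InT⇒T-bounded w (f , eq) with split (tabulate f)
  ... | k , l , k+l≡ , s = k , l , trans k+l≡ (length-tabulate f) ,
        ≤-reflexive (trans (P-coloured w f eq) (pairProduct-split s))

  InT-colouring : ∀ k l → ∃ λ (w : Multigraph (k + l)) → InT 2 1 a (k + l) w × InF (k + l) 4 (6 * a + 3) w × P w ≡ T k l
  InT-colouring k l with colouring k l
  ... | f , s = w , (f , λ _ _ _ → refl) , w∈F , trans (P-coloured w f (λ _ _ _ → refl)) (pairProduct-split s)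
    where
    w : Multigraph (k + l)
    w i j = c (f i) (f j)
    w∈F : InF (k + l) 4 (6 * a + 3) w
    w∈F X ∣X∣≡4 = ≤-trans (≤-reflexive (eIn≡pairSum w X)) (quads (members X) (trans (length-members X) ∣X∣≡4))
      where
      quads : ∀ xs → length xs ≡ 4 → pairSum w xs ≤ 6 * a + 3
      quads (x ∷ y ∷ z ∷ t ∷ []) refl = four-colours (f x) (f y) (f z) (f t)

  best : ℕ → ℕ
  best n = argmax (λ k → T k (n ∸ k)) 0 (upTo (suc n))

  best≤n : ∀ n → best n ≤ n
  best≤n n = argmax-all (λ k → T k (n ∸ k)) {P = _≤ n} z≤n (All.map ≤-pred (all-upTo (suc n)))

  T≤T-best : ∀ {n X} → T-bounded n X → X ≤ T (best n) (n ∸ best n)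
  T≤T-best (k , l , refl , X≤T) = ≤-trans X≤T (≤-trans (≤-reflexive (cong (T k) (sym (m+n∸m≡n k l))))
    (All.lookup (f[xs]≤f[argmax] {f = λ j → T j (k + l ∸ j)} 0 (upTo (suc (k + l)))) (∈-upTo⁺ (s≤s (m≤m+n k l)))))

  -- A single graph attains both maxima: the coloured graph with |V_0| = `best n` belongs to both
  -- families, and each member of either family is bounded by some `T k l` with k + l = n.
  extremal : ∀ n → 30 ≤ n → ∃ λ m → IsMaxP n (InF n 4 (6 * a + 3)) m × IsMaxP n (InT 2 1 a n) m
  extremal n 30≤n = m , ((w , w∈F , Pw≡m) , λ v v∈F → T≤T-best (InF⇒T-bounded 30≤n v v∈F))
                      , ((w , w∈T , Pw≡m) , λ v v∈T → T≤T-best (InT⇒T-bounded v v∈T))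
    where
    m = T (best n) (n ∸ best n)
    optimum : ∃ λ (w : Multigraph n) → InT 2 1 a n w × InF n 4 (6 * a + 3) w × P w ≡ m
    optimum = subst (λ N → ∃ λ (w : Multigraph N) → InT 2 1 a N w × InF N 4 (6 * a + 3) w × P w ≡ m)
      (m+[n∸m]≡n (best≤n n)) (InT-colouring (best n) (n ∸ best n))
    w = proj₁ optimum
    w∈T = proj₁ (proj₂ optimum)
    w∈F = proj₁ (proj₂ (proj₂ optimum))
    Pw≡m = proj₂ (proj₂ (proj₂ optimum))

theorem3p5 : (a n : ℕ) → 2 ≤ a → 30 ≤ n →
    ∃ λ m → IsMaxP n (InF n 4 (6 * a + 3)) m × IsMaxP n (InT 2 1 a n) m
theorem3p5 (suc b) n (s≤s 1≤b) 30≤n = Colours.extremal b 1≤b n 30≤n
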